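{- There is a constant $c>0$ such that for all sufficiently large $m$ the following holds: if $F$ is a clause-set representing $\mathrm{PHP}^m_m$ (with respect to the variable set $V_m=\{p_{i,j}: i,j\in\{1,\dots,m\}\}$) and $\mathrm{hd}^{V_m}(F)\le 1$, then $\ell(F)\ge m^{c\log m}$ (i.e. $\ell(F)=m^{\Omega(\log m)}$).
   Context: Literals are variables $v$ or negations $\overline{v}$; clauses are finite sets of literals without complementary pair; clause-sets finite sets of clauses; $\bot$ empty clause, $\top$ empty clause-set; $\ell(F)=\sum_{C\in F}|C|$. A partial assignment $\varphi$ maps a finite variable set $\mathrm{var}(\varphi)$ to $\{0,1\}$; $\varphi*F$ removes satisfied clauses and false literals; $F$ is unsatisfiable if no $\varphi$ gives $\varphi*F=\top$. $\mathrm{PHP}^m_m$ has variables $p_{i,j}$ ($i,j\in\{1,\dots,m\}$) and clauses $\{p_{i,1},\dots,p_{i,m}\}$ for each $i$, and $\{\overline{p_{i_1,j}},\overline{p_{i_2,j}}\}$ for all $j$ and $i_1\ne i_2$. A clause-set $F$ with $V_m\subseteq\mathrm{var}(F)$ represents $\mathrm{PHP}^m_m$ if the restrictions to $V_m$ of the total satisfying assignments of $F$ are exactly the satisfying assignments of $\mathrm{PHP}^m_m$. Hardness: resolution of $C,D$ with exactly one clash $x\in C,\overline{x}\in D$ gives $(C\cup D)\setminus\{x,\overline{x}\}$; a resolution tree is a finite rooted tree, inner nodes with two children, labelled by clauses, inner labels resolvents of children's labels; a refutation of $F$ has leaf labels in $F$ and root $\bot$. Horton–Strahler number: $0$ for one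 node; for subtrees $T_1,T_2$ it is $\mathrm{hts}(T_1)+1$ if $\mathrm{hts}(T_1)=\mathrm{hts}(T_2)$, else the maximum. For unsatisfiable $F$, $\mathrm{hd}(F)$ is the minimal Horton–Strahler number of a refutation of $F$. Relativised hardness for a variable set $V$: $\mathrm{hd}^V(\top)=0$ and for $F\ne\top$, $\mathrm{hd}^V(F)$ is the maximum of $\mathrm{hd}(\varphi*F)$ over partial assignments $\varphi$ with $\mathrm{var}(\varphi)\subseteq V$ and $\varphi*F$ unsatisfiable. -}

module Defs where

open import Data.Nat using (ℕ; zero; suc; _≤_; _≡ᵇ_; _⊔_; _+_)
open import Data.Bool using (Bool; true; false; if_then_else_; not; _∧_; _∨_)
open import Data.Maybe using (Maybe; just; nothing)
open import Data.List using (List; []; _∷_; map; concatMap; upTo; length; [_])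
open import Data.Nat.ListAction using (sum)
open import Data.List.Membership.Propositional using (_∈_)
open import Data.List.Relation.Unary.All using (All)
open import Data.List.Relation.Unary.Any using (Any)
open import Data.List.Relation.Unary.Unique.Propositional using (Unique)
open import Data.List.Relation.Unary.AllPairs using (AllPairs)
open import Data.Product using (Σ; _×_; ∃)
open import Data.Sum using (_⊎_)
open import Relation.Nullary using (¬_)
open import Relation.Binary.PropositionalEquality using (_≡_; _≢_)

data Var : Set where
  p   : ℕ → ℕ → Var
  aux : ℕ → Var

record Lit : Set where
  constructor mkLit
  field
    var  : Var
    sign : Bool
open Lit public

pos neg : Var → Lit
pos v = mkLit v true
neg v = mkLit v false

compl : Lit → Lit
compl (mkLit v s) = mkLit v (not s)

-- Clauses and clause-sets as lists (read as finite sets).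
Clause : Set
Clause = List Lit

ClauseSet : Set
ClauseSet = List Clause

_≋_ : Clause → Clause → Set
C ≋ D = ∀ l → (l ∈ C → l ∈ D) × (l ∈ D → l ∈ C)

IsClause : Clause → Set
IsClause C = Unique C × (∀ l → l ∈ C → ¬ (compl l ∈ C))

IsClauseSet : ClauseSet → Set
IsClauseSet F = All IsClause F × AllPairs (λ C D → ¬ (C ≋ D)) F

ℓ : ClauseSet → ℕ
ℓ F = sum (map length F)

OccursIn : Var → ClauseSet → Set
OccursIn v F = Any (λ C → Any (λ l → var l ≡ v) C) F

PAss : Set
PAss = Var → Maybe Bool

beq : Bool → Bool → Bool
beq true  b = b
beq false b = not b

litTrue : PAss → Lit → Bool
litTrue φ (mkLit v s) with φ v
... | just b  = beq b s
... | nothing = false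

litFalse : PAss → Lit → Bool
litFalse φ (mkLit v s) with φ v
... | just b  = not (beq b s)
... | nothing = false

clauseSatP : PAss → Clause → Bool
clauseSatP φ []      = false
clauseSatP φ (l ∷ C) = litTrue φ l ∨ clauseSatP φ C

removeFalse : PAss → Clause → Clause
removeFalse φ []      = []
removeFalse φ (l ∷ C) = if litFalse φ l then removeFalse φ C else l ∷ removeFalse φ C

_*_ : PAss → ClauseSet → ClauseSet
φ * []      = []
φ * (C ∷ F) = if clauseSatP φ C then φ * F else removeFalse φ C ∷ (φ * F)

Unsat : ClauseSet → Set
Unsat F = ∀ (φ : PAss) → φ * F ≢ []

Sat : (Var → Bool) → ClauseSet → Set
Sat β F = All (λ C → Any (λ l → β (var l) ≡ sign l) C) F

Resolvent : Clause → Clause → Clause → Set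
Resolvent C D R = Σ Lit λ x →
  (x ∈ C) × (compl x ∈ D) ×
  (∀ y → y ∈ C → compl y ∈ D → y ≡ x) ×
  (∀ l → (l ∈ R → (l ∈ C ⊎ l ∈ D) × l ≢ x × l ≢ compl x)
       × ((l ∈ C ⊎ l ∈ D) × l ≢ x × l ≢ compl x → l ∈ R))

data Tree : Set where
  leaf : Clause → Tree
  node : Clause → Tree → Tree → Tree

label : Tree → Clause
label (leaf C)     = C
label (node C _ _) = C

ValidTree : Tree → Set
ValidTree (leaf C)       = Data.Unit.⊤
  where import Data.Unit
ValidTree (node C T₁ T₂) = Resolvent (label T₁) (label T₂) C × ValidTree T₁ × ValidTree T₂

LeavesIn : ClauseSet → Tree → Set
LeavesIn F (leaf C)       = Any (λ D → C ≋ D) F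
LeavesIn F (node _ T₁ T₂) = LeavesIn F T₁ × LeavesIn F T₂

Refutation : ClauseSet → Tree → Set
Refutation F T = ValidTree T × LeavesIn F T × label T ≡ []

hts : Tree → ℕ
hts (leaf _)       = 0
hts (node _ T₁ T₂) = if hts T₁ ≡ᵇ hts T₂ then suc (hts T₁) else hts T₁ ⊔ hts T₂

-- hd(F) ≤ k  (hd(F) is the minimal hts of a refutation).
HdLe : ClauseSet → ℕ → Set
HdLe F k = Σ Tree λ T → Refutation F T × hts T ≤ k

HdVLe : (Var → Set) → ClauseSet → ℕ → Set
HdVLe V F k = ∀ (φ : PAss) → (∀ v → ¬ V v → φ v ≡ nothing) →
              Unsat (φ * F) → HdLe (φ * F) k

idx : ℕ → List ℕ
idx m = map suc (upTo m)

PHP : ℕ → ClauseSet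
PHP m = map (λ i → map (λ j → pos (p i j)) (idx m)) (idx m)
  Data.List.++ concatMap (λ j → concatMap (λ i₁ → concatMap (λ i₂ →
        if i₁ ≡ᵇ i₂ then [] else [ neg (p i₁ j) ∷ neg (p i₂ j) ∷ [] ])
        (idx m)) (idx m)) (idx m)
  where import Data.List

InRange : ℕ → ℕ → Set
InRange m i = 1 ≤ i × i ≤ m

Vm : ℕ → Var → Set
Vm m v = Σ ℕ λ i → Σ ℕ λ j → InRange m i × InRange m j × v ≡ p i j

Represents : ℕ → ClauseSet → Set
Represents m F =
  (∀ i j → InRange m i → InRange m j → OccursIn (p i j) F) ×
  (∀ (α : Var → Bool) →
     (Sat α (PHP m) →
        Σ (Var → Bool) λ β → Sat β F × (∀ i j → InRange m i → InRange m j → β (p i j) ≡ α (p i j)))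
   × (Σ (Var → Bool) (λ β → Sat β F × (∀ i j → InRange m i → InRange m j → β (p i j) ≡ α (p i j)))
        → Sat α (PHP m)))

{-# OPTIONS --safe #-}
-- Razborov's method of approximations for bipartite perfect matching, applied to unit propagation.
--
-- Restrict F by falsifying the variables of the edges missing from a bipartite graph G. Input
-- resolution (Horton–Strahler number 1) is unit propagation, so the literals left underived after
-- ℓ(F)-many rounds form a monotone network of size polynomial in ℓ(F) which accepts every perfect
-- matching and rejects every graph without one.
--
-- The rejected graphs come from two-colourings of the rows and columns of odd parity, an edge being
-- present when its ends agree; a matching of size k lies in the graph of a random colouring with
-- probability 2^(-k), while k given edges lie in a random perfect matching with probability about
-- m^(-k). Each node of the network is approximated by a family of edge sets of size ≤ r. An OR is the
-- union of families followed by one closure step: B is added when at most a 2^(-q) fraction of all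
-- colourings make B monochromatic without being accepted. An AND is an intersection. For a set B missing
-- from a closure there are core² edges such that every matching of the family uses one of them outside B
-- (otherwise one could pick too many members whose hits on a random colouring are independent), hence
-- an AND only loses the perfect matchings through one of core^(2(r+1)) sets of size r+1. With
-- r ≈ (log m)/16, a network of size below 2^(r²) makes too few errors of either kind.
module Submission where

open import Defs hiding (_*_)
open import Defs using () renaming (_*_ to _⋆_)
open import Data.Bool using (Bool; true; false; not; _∧_; _xor_; if_then_else_; T)
open import Data.Bool.ListAction using (all; any)
open import Data.Bool.Properties using (∧-comm; ∧-assoc; not-involutive; not-distribˡ-xor; not-distribʳ-xor; xor-same; xor-assoc; xor-comm; not-¬; ¬-not)
import Data.Bool.Properties as Bool
open import Data.Empty using (⊥; ⊥-elim)
open import Data.Fin using (Fin; zero; suc; toℕ; fromℕ<)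
open import Data.Fin.Permutation.Components using (transpose; transpose-inverse)
open import Data.Fin.Properties using (_≟_; all?; toℕ<n; toℕ-fromℕ<; fromℕ<-toℕ; toℕ-injective)
open import Data.List using (List; []; _∷_; map; concatMap; concat; length; _++_; filter; allFin; foldr; tabulate; cartesianProduct)
open import Data.List.Membership.Propositional using (_∈_; _∉_; find; lose)
open import Data.List.Membership.Propositional.Properties using (∈-map⁺; ∈-map⁻; ∈-allFin; ∈-concatMap⁺; ∈-concatMap⁻; ∈-concat⁺′; ∈-++⁺ˡ; ∈-++⁺ʳ; ∈-++⁻; ∈-∃++; ∈-filter⁺; ∈-filter⁻; ∈-upTo⁺; ∈-upTo⁻; ∈-cartesianProduct⁺)
import Data.List.Membership.DecPropositional as DecMembership
open import Data.List.Properties using (map-∘; map-cong; length-map; length-tabulate; length-++; map-tabulate)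
open import Data.List.Relation.Binary.Permutation.Propositional as ↭ using (_↭_; ↭-refl; ↭-sym; ↭-trans; prep; swap)
open import Data.List.Relation.Binary.Permutation.Propositional.Properties using (map⁺; shift; ↭-length; ++-comm)
open import Data.List.Relation.Unary.All as All using (All; []; _∷_)
import Data.List.Relation.Unary.All.Properties as All
open import Data.List.Relation.Unary.AllPairs using (AllPairs; []; _∷_; allPairs?)
open import Data.List.Relation.Unary.Any as Any using (Any; here; there)
open import Data.List.Relation.Unary.Unique.Propositional using (Unique)
import Data.List.Relation.Unary.Unique.Propositional.Properties as Unique
open import Data.Maybe using (Maybe; just; nothing; maybe′)
import Data.Maybe.Properties as Maybe
open import Data.Nat using (ℕ; zero; suc; _+_; _*_; _∸_; _^_; _≤_; _<_; z≤n; s≤s; >-nonZero; _≤?_; _<?_; _≡ᵇ_; _/_)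
open import Data.Nat.DivMod using (m≡m%n+[m/n]*n; m%n<n; m/n*n≤m)
open import Data.Nat.ListAction using (sum)
open import Data.Nat.ListAction.Properties using (sum-↭)
open import Data.Nat.Logarithm using (⌊log₂_⌋; ⌊log₂⌋-mono-≤; ⌊log₂[2^n]⌋≡n)
open import Data.Nat.Properties hiding (_≟_; _≤?_; _<?_)
import Data.Nat.Properties as ℕ
open import Data.Nat.Solver using (module +-*-Solver)
open import Data.Product using (Σ; _×_; _,_; proj₁; proj₂; map₁; map₂)
open import Data.Product.Properties using (≡-dec)
open import Data.Sum as Sum using (_⊎_; inj₁; inj₂)
open import Data.Unit using (⊤; tt)
open import Data.Vec as Vec using (Vec; []; _∷_; lookup; updateAt)
open import Data.Vec.Properties using (lookup-map; lookup∘tabulate; lookup∘updateAt; lookup∘updateAt′)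
open import Function using (_∘_; id; mk⇔)
open import Relation.Binary.PropositionalEquality
open import Relation.Nullary using (¬_; Dec; yes; no; does; ¬?)
open import Relation.Nullary.Decidable using (_×-dec_; _⊎-dec_; _→-dec_; dec-true; dec-false; does-⇔; map′)

private
  variable
    A B X : Set

-- Counting with Boolean predicates on lists

𝟙 : Bool → ℕ
𝟙 true  = 1
𝟙 false = 0

# : (X → Bool) → List X → ℕ
# P []       = 0
# P (x ∷ xs) = 𝟙 (P x) + # P xs

_⇛_ : (X → Bool) → (X → Bool) → Set
P ⇛ Q = ∀ x → P x ≡ true → Q x ≡ true

∧-introᵇ : ∀ {a b} → a ≡ true → b ≡ true → a ∧ b ≡ true
∧-introᵇ refl refl = refl

∧-elimˡ : ∀ a {b} → a ∧ b ≡ true → a ≡ true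
∧-elimˡ true _ = refl

∧-elimʳ : ∀ a {b} → a ∧ b ≡ true → b ≡ true
∧-elimʳ true eq = eq

true≢false : ∀ {a} → a ≡ true → a ≡ false → ⊥
true≢false refl ()

𝟙-mono : ∀ a b → (a ≡ true → b ≡ true) → 𝟙 a ≤ 𝟙 b
𝟙-mono false b     f = z≤n
𝟙-mono true  true  f = ≤-refl
𝟙-mono true  false f = ⊥-elim (true≢false (f refl) refl)

#-mono : ∀ {P Q : X → Bool} → P ⇛ Q → ∀ xs → # P xs ≤ # Q xs
#-mono f []       = z≤n
#-mono f (x ∷ xs) = +-mono-≤ (𝟙-mono _ _ (f x)) (#-mono f xs)

#-cong : ∀ {P Q : X → Bool} → (∀ x → P x ≡ Q x) → ∀ xs → # P xs ≡ # Q xs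
#-cong f []       = refl
#-cong f (x ∷ xs) = cong₂ (λ a n → 𝟙 a + n) (f x) (#-cong f xs)

+-interchange : ∀ a b c d → (a + b) + (c + d) ≡ (a + c) + (b + d)
+-interchange a b c d = begin
  (a + b) + (c + d) ≡⟨ +-assoc a b (c + d) ⟩
  a + (b + (c + d)) ≡⟨ cong (a +_) (sym (+-assoc b c d)) ⟩
  a + ((b + c) + d) ≡⟨ cong (λ z → a + (z + d)) (+-comm b c) ⟩
  a + ((c + b) + d) ≡⟨ cong (a +_) (+-assoc c b d) ⟩
  a + (c + (b + d)) ≡⟨ sym (+-assoc a c (b + d)) ⟩
  (a + c) + (b + d) ∎
  where open ≡-Reasoning

𝟙-split : ∀ a b → 𝟙 a ≡ 𝟙 (a ∧ b) + 𝟙 (a ∧ not b)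
𝟙-split false b     = refl
𝟙-split true  true  = refl
𝟙-split true  false = refl

#-split : ∀ (P Q : X → Bool) xs → # P xs ≡ # (λ x → P x ∧ Q x) xs + # (λ x → P x ∧ not (Q x)) xs
#-split P Q []       = refl
#-split P Q (x ∷ xs) = trans (cong₂ _+_ (𝟙-split (P x) (Q x)) (#-split P Q xs))
  (+-interchange (𝟙 (P x ∧ Q x)) _ _ _)

#-positive : ∀ (P : X → Bool) xs → 0 < # P xs → Σ X λ x → x ∈ xs × P x ≡ true
#-positive P (x ∷ xs) lt with P x in eq
... | true  = x , here refl , eq
... | false with #-positive P xs lt
...   | y , y∈ , py = y , there y∈ , py

#-witness : ∀ (P : X → Bool) {x} xs → x ∈ xs → P x ≡ true → 1 ≤ # P xs
#-witness P (x ∷ xs) (here refl) px rewrite px = s≤s z≤n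
#-witness P (x ∷ xs) (there x∈)  px = ≤-trans (#-witness P xs x∈ px) (m≤n+m _ _)

#-≤-length : ∀ (P : X → Bool) xs → # P xs ≤ length xs
#-≤-length P []       = z≤n
#-≤-length P (x ∷ xs) = +-mono-≤ (𝟙-mono (P x) true (λ _ → refl)) (#-≤-length P xs)

#-++ : ∀ (P : X → Bool) xs ys → # P (xs ++ ys) ≡ # P xs + # P ys
#-++ P []       ys = refl
#-++ P (x ∷ xs) ys = trans (cong (𝟙 (P x) +_) (#-++ P xs ys)) (sym (+-assoc (𝟙 (P x)) _ _))

#-map : ∀ (P : X → Bool) (f : A → X) as → # P (map f as) ≡ # (P ∘ f) as
#-map P f []       = refl
#-map P f (a ∷ as) = cong (𝟙 (P (f a)) +_) (#-map P f as)

#-concatMap : ∀ (P : X → Bool) (f : A → List X) as →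
              # P (concatMap f as) ≡ sum (map (λ a → # P (f a)) as)
#-concatMap P f []       = refl
#-concatMap P f (a ∷ as) = trans (#-++ P (f a) _) (cong (# P (f a) +_) (#-concatMap P f as))

-- The union bound in counting form: the events are removed one at a time, and each removal costs
-- `P` at most `# E xs`.
#-avoid : ∀ (Es : List (X → Bool)) (P : X → Bool) xs → sum (map (λ E → # E xs) Es) < # P xs →
          Σ X λ x → P x ≡ true × All (λ E → E x ≡ false) Es
#-avoid []       P xs lt with #-positive P xs lt
... | x , _ , px = x , px , []
#-avoid (E ∷ Es) P xs lt with #-avoid Es (λ x → P x ∧ not (E x)) xs (+-cancelˡ-< (# E xs) _ _ (begin-strict
    # E xs + sum (map (λ E → # E xs) Es)                          <⟨ lt ⟩
    # P xs                                                        ≡⟨ #-split P E xs ⟩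
    # (λ x → P x ∧ E x) xs + # (λ x → P x ∧ not (E x)) xs         ≤⟨ +-monoˡ-≤ _ (#-mono (λ x → ∧-elimʳ (P x)) xs) ⟩
    # E xs + # (λ x → P x ∧ not (E x)) xs                         ∎))
  where open ≤-Reasoning
... | x , px , as = x , ∧-elimˡ (P x) px , not-true (E x) (∧-elimʳ (P x) px) ∷ as
  where
  not-true : ∀ b → not b ≡ true → b ≡ false
  not-true false _ = refl

-- Distinct values have disjoint fibres. After the fibre over `j` is removed from `P`, the other
-- fibres keep their size, so induction applies to `P′`.
#-fibres : ∀ {J : Set} (_≟_ : (i j : J) → Dec (i ≡ j)) (P : X → Bool) (g : X → J) {js} → Unique js →
           ∀ xs → sum (map (λ j → # (λ x → P x ∧ does (g x ≟ j)) xs) js) ≤ # P xs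
#-fibres _≟_ P g []                         xs = z≤n
#-fibres _≟_ P g {js = j ∷ js} (j∉ ∷ js!) xs = begin
  # (λ x → P x ∧ does (g x ≟ j)) xs + sum (map (λ j′ → # (λ x → P x ∧ does (g x ≟ j′)) xs) js)
    ≤⟨ +-monoʳ-≤ (# (λ x → P x ∧ does (g x ≟ j)) xs) (≤-trans (rest js j∉) (#-fibres _≟_ P′ g js! xs)) ⟩
  # (λ x → P x ∧ does (g x ≟ j)) xs + # P′ xs
    ≡⟨ sym (#-split P (λ x → does (g x ≟ j)) xs) ⟩
  # P xs ∎
  where
  open ≤-Reasoning
  P′ : _ → Bool
  P′ x = P x ∧ not (does (g x ≟ j))
  away : ∀ {j′} → j ≢ j′ → (λ x → P x ∧ does (g x ≟ j′)) ⇛ (λ x → P′ x ∧ does (g x ≟ j′))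
  away {j′} ne x eq with P x | g x ≟ j′ | g x ≟ j
  ... | true | yes refl | yes refl = ⊥-elim (ne refl)
  ... | true | yes refl | no _ = refl
  rest : ∀ is → All (j ≢_) is → sum (map (λ j′ → # (λ x → P x ∧ does (g x ≟ j′)) xs) is)
                              ≤ sum (map (λ j′ → # (λ x → P′ x ∧ does (g x ≟ j′)) xs) is)
  rest []       []         = z≤n
  rest (i ∷ is) (ne ∷ nes) = +-mono-≤ (#-mono (away ne) xs) (rest is nes)

sum-bounded : ∀ (f : A → ℕ) b as → All (λ a → f a ≤ b) as → sum (map f as) ≤ length as * b
sum-bounded f b []       []       = z≤n
sum-bounded f b (a ∷ as) (b₁ ∷ bs) = +-mono-≤ b₁ (sum-bounded f b as bs)

sum-constant : ∀ (f : A → ℕ) b as → All (λ a → f a ≡ b) as → sum (map f as) ≡ length as * b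
sum-constant f b []       []       = refl
sum-constant f b (a ∷ as) (b₁ ∷ bs) = cong₂ _+_ b₁ (sum-constant f b as bs)

sum-*ʳ : ∀ (f : A → ℕ) c as → sum (map f as) * c ≡ sum (map (λ a → f a * c) as)
sum-*ʳ f c []       = refl
sum-*ʳ f c (a ∷ as) = trans (*-distribʳ-+ c (f a) _) (cong (f a * c +_) (sum-*ʳ f c as))

-- Product spaces and their symmetries

vecs : List A → ∀ n → List (Vec A n)
vecs as zero    = [] ∷ []
vecs as (suc n) = concatMap (λ a → map (a ∷_) (vecs as n)) as

#-vecs-suc : ∀ (as : List A) n (P : Vec A (suc n) → Bool) →
             # P (vecs as (suc n)) ≡ sum (map (λ a → # (P ∘ (a ∷_)) (vecs as n)) as)
#-vecs-suc as n P = trans (#-concatMap P _ as)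
  (cong sum (map-cong (λ a → #-map P (a ∷_) (vecs as n)) as))

∈-vecs : ∀ {as : List A} → (∀ a → a ∈ as) → ∀ {n} (v : Vec A n) → v ∈ vecs as n
∈-vecs full []      = here refl
∈-vecs full (a ∷ v) = ∈-concatMap⁺ _ (lose (full a) (∈-map⁺ (a ∷_) (∈-vecs full v)))

sum-reindex : ∀ (as : List A) (σ : A → A) → map σ as ↭ as → ∀ (g : A → ℕ) →
              sum (map (g ∘ σ) as) ≡ sum (map g as)
sum-reindex as σ perm g = trans (cong sum (map-∘ as)) (sum-↭ (map⁺ g perm))

-- Measure preservation: a permutation of the alphabet in one coordinate permutes the whole product
-- space. It serves to recolour a single vertex.
#-vecs-updateAt : ∀ (as : List A) (σ : A → A) → map σ as ↭ as → ∀ {n} (i : Fin n) (P : Vec A n → Bool) →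
                  # (λ v → P (updateAt v i σ)) (vecs as n) ≡ # P (vecs as n)
#-vecs-updateAt as σ perm {suc n} zero P = begin
  # (λ v → P (updateAt v zero σ)) (vecs as (suc n))          ≡⟨ #-vecs-suc as n _ ⟩
  sum (map (λ a → # (P ∘ (σ a ∷_)) (vecs as n)) as)          ≡⟨ sum-reindex as σ perm (λ a → # (P ∘ (a ∷_)) (vecs as n)) ⟩
  sum (map (λ a → # (P ∘ (a ∷_)) (vecs as n)) as)            ≡⟨ sym (#-vecs-suc as n P) ⟩
  # P (vecs as (suc n))                                      ∎
  where open ≡-Reasoning
#-vecs-updateAt as σ perm {suc n} (suc i) P = begin
  # (λ v → P (updateAt v (suc i) σ)) (vecs as (suc n))                     ≡⟨ #-vecs-suc as n _ ⟩
  sum (map (λ a → # (λ v → P (a ∷ updateAt v i σ)) (vecs as n)) as)        ≡⟨ cong sum (map-cong (λ a → #-vecs-updateAt as σ perm i (P ∘ (a ∷_))) as) ⟩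
  sum (map (λ a → # (P ∘ (a ∷_)) (vecs as n)) as)                          ≡⟨ sym (#-vecs-suc as n P) ⟩
  # P (vecs as (suc n))                                                    ∎
  where open ≡-Reasoning

#-vecs-map : ∀ (as : List A) (σ : A → A) → map σ as ↭ as → ∀ n (P : Vec A n → Bool) →
             # (λ v → P (Vec.map σ v)) (vecs as n) ≡ # P (vecs as n)
#-vecs-map as σ perm zero    P = refl
#-vecs-map as σ perm (suc n) P = begin
  # (λ v → P (Vec.map σ v)) (vecs as (suc n))                              ≡⟨ #-vecs-suc as n _ ⟩
  sum (map (λ a → # (λ v → P (σ a ∷ Vec.map σ v)) (vecs as n)) as)         ≡⟨ cong sum (map-cong (λ a → #-vecs-map as σ perm n (P ∘ (σ a ∷_))) as) ⟩
  sum (map (λ a → # (P ∘ (σ a ∷_)) (vecs as n)) as)                        ≡⟨ sum-reindex as σ perm (λ a → # (P ∘ (a ∷_)) (vecs as n)) ⟩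
  sum (map (λ a → # (P ∘ (a ∷_)) (vecs as n)) as)                          ≡⟨ sym (#-vecs-suc as n P) ⟩
  # P (vecs as (suc n))                                                    ∎
  where open ≡-Reasoning

-- Pigeonhole for duplicate-free lists

∈-remove : ∀ {x y : A} ys zs → x ∈ ys ++ y ∷ zs → x ≢ y → x ∈ ys ++ zs
∈-remove ys zs x∈ x≢y with ∈-++⁻ ys x∈
... | inj₁ x∈ys          = ∈-++⁺ˡ x∈ys
... | inj₂ (here x≡y)    = ⊥-elim (x≢y x≡y)
... | inj₂ (there x∈zs)  = ∈-++⁺ʳ ys x∈zs

unique-⊆-length : ∀ {xs ys : List A} → Unique xs → (∀ {x} → x ∈ xs → x ∈ ys) → length xs ≤ length ys
unique-⊆-length []          sub = z≤n
unique-⊆-length {xs = x ∷ xs} (x∉ ∷ xs!) sub with ∈-∃++ (sub (here refl))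
... | as , bs , refl = ≤-trans (s≤s (unique-⊆-length xs! sub′)) (≤-reflexive (sym (↭-length (shift x as bs))))
  where
  sub′ : ∀ {y} → y ∈ xs → y ∈ as ++ bs
  sub′ y∈ = ∈-remove as bs (sub (there y∈)) (λ y≡x → All.lookup x∉ y∈ (sym y≡x))

-- Each element of `xs` uses up one place of `ys`. In this way injective self-maps of a finite set
-- become permutations.
unique-⊆-↭ : ∀ {xs ys : List A} → Unique xs → (∀ {x} → x ∈ xs → x ∈ ys) → length ys ≤ length xs → xs ↭ ys
unique-⊆-↭ {ys = []}    []  sub le = ↭-refl
unique-⊆-↭ {xs = x ∷ xs} (x∉ ∷ xs!) sub le with ∈-∃++ (sub (here refl))
... | as , bs , refl = ↭-trans (prep x (unique-⊆-↭ xs! sub′ le′)) (↭-sym (shift x as bs))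
  where
  sub′ : ∀ {y} → y ∈ xs → y ∈ as ++ bs
  sub′ y∈ = ∈-remove as bs (sub (there y∈)) (λ y≡x → All.lookup x∉ y∈ (sym y≡x))
  le′ : length (as ++ bs) ≤ length xs
  le′ = ≤-pred (≤-trans (≤-reflexive (sym (↭-length (shift x as bs)))) le)

-- Extensions of partial injections

does-true : ∀ {P : Set} (d : Dec P) → does d ≡ true → P
does-true (yes holds) _ = holds

does-false : ∀ {P : Set} (d : Dec P) → does d ≡ false → ¬ P
does-false (no fails) _ = fails

Edge : ℕ → Set
Edge m = Fin m × Fin m

Disjoint : ∀ {m} → Edge m → Edge m → Set
Disjoint e e′ = proj₁ e ≢ proj₁ e′ × proj₂ e ≢ proj₂ e′

IsInj : ∀ {m} → Vec (Fin m) m → Set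
IsInj f = ∀ i j → lookup f i ≡ lookup f j → i ≡ j

_∋_ : ∀ {m} → Vec (Fin m) m → Edge m → Set
f ∋ e = lookup f (proj₁ e) ≡ proj₂ e

indicator : ∀ {m} → Vec (Fin m) m → Edge m → Bool
indicator f (i , j) = does (lookup f i ≟ j)

injective-allFin-↭ : ∀ {m} (σ : Fin m → Fin m) → (∀ {i j} → σ i ≡ σ j → i ≡ j) →
                     map σ (allFin m) ↭ allFin m
injective-allFin-↭ {m} σ σ-inj = unique-⊆-↭ (Unique.map⁺ σ-inj (Unique.allFin⁺ m)) (λ _ → ∈-allFin _)
  (≤-reflexive (sym (length-map σ (allFin m))))

transpose-injective : ∀ {m} (i j : Fin m) {k l} → transpose i j k ≡ transpose i j l → k ≡ l
transpose-injective i j {k} {l} eq = begin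
  k                                 ≡⟨ sym (transpose-inverse j i) ⟩
  transpose j i (transpose i j k)   ≡⟨ cong (transpose j i) eq ⟩
  transpose j i (transpose i j l)   ≡⟨ transpose-inverse j i ⟩
  l                                 ∎
  where open ≡-Reasoning

transpose-source : ∀ {m} (i j : Fin m) → transpose i j i ≡ j
transpose-source i j rewrite dec-true (i ≟ i) refl = refl

transpose-fixed : ∀ {m} {i j k : Fin m} → k ≢ i → k ≢ j → transpose i j k ≡ k
transpose-fixed {i = i} {j} {k} k≢i k≢j rewrite dec-false (k ≟ i) k≢i | dec-false (k ≟ j) k≢j = refl

length-filter-∉ : ∀ {m} (cs : List (Fin m)) →
                  m ≤ length (filter (λ j → ¬? (DecMembership._∈?_ _≟_ j cs)) (allFin m)) + length cs
length-filter-∉ {m} cs = begin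
  m                      ≡⟨ sym (length-tabulate id) ⟩
  length (allFin m)      ≤⟨ unique-⊆-length (Unique.allFin⁺ m) sub ⟩
  length (free ++ cs)    ≡⟨ length-++ free ⟩
  length free + length cs ∎
  where
  open ≤-Reasoning
  open DecMembership (_≟_ {m}) using (_∈?_)
  free : List (Fin m)
  free = filter (λ j → ¬? (j ∈? cs)) (allFin m)
  sub : ∀ {j} → j ∈ allFin m → j ∈ free ++ cs
  sub {j} j∈ with j ∈? cs
  ... | yes j∈cs = ∈-++⁺ʳ free j∈cs
  ... | no  j∉cs = ∈-++⁺ˡ (∈-filter⁺ (λ j → ¬? (j ∈? cs)) j∈ j∉cs)

module _ {m : ℕ} where

  maps : List (Vec (Fin m) m)
  maps = vecs (allFin m) m

  injective? : (f : Vec (Fin m) m) → Dec (IsInj f)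
  injective? f = all? λ i → all? λ j → (lookup f i ≟ lookup f j) →-dec (i ≟ j)

  extends? : (L : List (Edge m)) (f : Vec (Fin m) m) → Dec (IsInj f × All (f ∋_) L)
  extends? L f = injective? f ×-dec All.all? (λ e → lookup f (proj₁ e) ≟ proj₂ e) L

  -- Injections of a finite set into itself are bijections, so this counts the perfect matchings of
  -- the complete bipartite graph that contain `L`.
  #extensions : List (Edge m) → ℕ
  #extensions L = # (λ f → does (extends? L f)) maps

  -- Composing with the transposition (j j′) carries the extensions of (i , j) ∷ L to those of (i , j′) ∷ L.
  #extensions-transpose : ∀ i {j j′} L → All (λ e → j ≢ proj₂ e) L → All (λ e → j′ ≢ proj₂ e) L →
                          #extensions ((i , j′) ∷ L) ≡ #extensions ((i , j) ∷ L)
  #extensions-transpose i {j} {j′} L j∉ j′∉ = begin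
    # (λ f → does (extends? ((i , j′) ∷ L) f)) maps
      ≡⟨ sym (#-vecs-map (allFin m) σ (injective-allFin-↭ σ (transpose-injective j j′)) m _) ⟩
    # (λ f → does (extends? ((i , j′) ∷ L) (Vec.map σ f))) maps
      ≡⟨ #-cong (λ f → does-⇔ (mk⇔ (to f) (from f)) (extends? ((i , j′) ∷ L) (Vec.map σ f)) (extends? ((i , j) ∷ L) f)) maps ⟩
    # (λ f → does (extends? ((i , j) ∷ L) f)) maps ∎
    where
    open ≡-Reasoning
    σ : Fin m → Fin m
    σ = transpose j j′
    σ-inj : ∀ {k l} → σ k ≡ σ l → k ≡ l
    σ-inj = transpose-injective j j′
    fixed : ∀ {e} → e ∈ L → σ (proj₂ e) ≡ proj₂ e
    fixed e∈ = transpose-fixed (λ eq → All.lookup j∉ e∈ (sym eq)) (λ eq → All.lookup j′∉ e∈ (sym eq))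
    to : ∀ f → IsInj (Vec.map σ f) × All (Vec.map σ f ∋_) ((i , j′) ∷ L) → IsInj f × All (f ∋_) ((i , j) ∷ L)
    to f (inj , fi ∷ fL) =
      (λ k l eq → inj k l (trans (lookup-map k σ f) (trans (cong σ eq) (sym (lookup-map l σ f))))) ,
      σ-inj (trans (sym (lookup-map i σ f)) (trans fi (sym (transpose-source j j′)))) ∷
      All.tabulate (λ {e} e∈ → σ-inj (trans (sym (lookup-map (proj₁ e) σ f)) (trans (All.lookup fL e∈) (sym (fixed e∈)))))
    from : ∀ f → IsInj f × All (f ∋_) ((i , j) ∷ L) → IsInj (Vec.map σ f) × All (Vec.map σ f ∋_) ((i , j′) ∷ L)
    from f (inj , fi ∷ fL) =
      (λ k l eq → inj k l (σ-inj (trans (sym (lookup-map k σ f)) (trans eq (lookup-map l σ f))))) ,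
      trans (lookup-map i σ f) (trans (cong σ fi) (transpose-source j j′)) ∷
      All.tabulate (λ {e} e∈ → trans (lookup-map (proj₁ e) σ f) (trans (cong σ (All.lookup fL e∈)) (fixed e∈)))

  -- The columns untouched by `L`, at least `m ∸ length L` in number, are interchangeable as images
  -- of row `i`, and their fibres within the extensions of `L` are disjoint.
  #extensions-step : ∀ {e} L → All (Disjoint e) L → #extensions (e ∷ L) * (m ∸ length L) ≤ #extensions L
  #extensions-step {i , j} L dis = begin
    #extensions ((i , j) ∷ L) * (m ∸ length L)
      ≤⟨ *-monoʳ-≤ (#extensions ((i , j) ∷ L)) enough ⟩
    #extensions ((i , j) ∷ L) * length free
      ≡⟨ *-comm _ (length free) ⟩
    length free * #extensions ((i , j) ∷ L)
      ≡⟨ sym (sum-constant _ _ free (All.tabulate same)) ⟩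
    sum (map (λ j′ → # (λ f → does (extends? L f) ∧ does (lookup f i ≟ j′)) maps) free)
      ≤⟨ #-fibres _≟_ (λ f → does (extends? L f)) (λ f → lookup f i) (Unique.filter⁺ free? (Unique.allFin⁺ m)) maps ⟩
    #extensions L ∎
    where
    open ≤-Reasoning
    open DecMembership (_≟_ {m}) using (_∈?_)
    cols : List (Fin m)
    cols = map proj₂ L
    free? = λ j′ → ¬? (j′ ∈? cols)
    free : List (Fin m)
    free = filter free? (allFin m)
    enough : m ∸ length L ≤ length free
    enough = begin
      m ∸ length L                             ≡⟨ cong (m ∸_) (sym (length-map proj₂ L)) ⟩
      m ∸ length cols                          ≤⟨ ∸-monoˡ-≤ (length cols) (length-filter-∉ cols) ⟩
      length free + length cols ∸ length cols  ≡⟨ m+n∸n≡m (length free) (length cols) ⟩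
      length free                              ∎
    split : ∀ j′ f → does (extends? L f) ∧ does (lookup f i ≟ j′) ≡ does (extends? ((i , j′) ∷ L) f)
    split j′ f = trans (∧-assoc (does (injective? f)) _ _) (cong (does (injective? f) ∧_) (∧-comm _ (does (lookup f i ≟ j′))))
    same : ∀ {j′} → j′ ∈ free → # (λ f → does (extends? L f) ∧ does (lookup f i ≟ j′)) maps ≡ #extensions ((i , j) ∷ L)
    same {j′} j′∈ = trans (#-cong (split j′) maps) (#extensions-transpose i L (All.map proj₂ dis)
      (All.tabulate (λ e∈ eq → proj₂ (∈-filter⁻ free? {xs = allFin m} j′∈) (subst (_∈ cols) (sym eq) (∈-map⁺ proj₂ e∈)))))

  -- The edges are prescribed one after another. Each joins at most `b` earlier ones and so gains a
  -- factor of at least `m ∸ b`; this is why `L` may have `b + 1` edges.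
  #extensions-bound : ∀ b L → AllPairs Disjoint L → length L ≤ suc b →
                      #extensions L * (m ∸ b) ^ length L ≤ #extensions []
  #extensions-bound b []      _            le       = ≤-reflexive (*-identityʳ _)
  #extensions-bound b (e ∷ L) (dis ∷ diss) (s≤s le) = begin
    #extensions (e ∷ L) * ((m ∸ b) * (m ∸ b) ^ length L)      ≡⟨ sym (*-assoc (#extensions (e ∷ L)) _ _) ⟩
    #extensions (e ∷ L) * (m ∸ b) * (m ∸ b) ^ length L        ≤⟨ *-monoˡ-≤ ((m ∸ b) ^ length L) (*-monoʳ-≤ (#extensions (e ∷ L)) (∸-monoʳ-≤ m le)) ⟩
    #extensions (e ∷ L) * (m ∸ length L) * (m ∸ b) ^ length L ≤⟨ *-monoˡ-≤ ((m ∸ b) ^ length L) (#extensions-step L dis) ⟩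
    #extensions L * (m ∸ b) ^ length L                        ≤⟨ #extensions-bound b L diss (m≤n⇒m≤1+n le) ⟩
    #extensions []                                            ∎
    where open ≤-Reasoning

  -- A union bound over `𝓛`: a random injection contains a fixed member with probability at most (m
  -- - r)^(-(r+1)).
  injection-avoiding : ∀ r (𝓛 : List (List (Edge m))) → All (λ L → length L ≡ suc r × AllPairs Disjoint L) 𝓛 →
                       length 𝓛 < (m ∸ r) ^ suc r →
                       Σ (Vec (Fin m) m) λ f → IsInj f × All (λ L → ¬ All (f ∋_) L) 𝓛
  injection-avoiding r 𝓛 good lt with #-avoid (map (λ L f → does (extends? L f)) 𝓛) (λ f → does (extends? [] f)) maps few
    where
    D = (m ∸ r) ^ suc r
    -- Some injection exists, which keeps the inequality in `few` strict.
    identity-extends : 1 ≤ #extensions []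
    identity-extends = #-witness _ maps (∈-vecs ∈-allFin (Vec.allFin m))
      (dec-true (extends? [] (Vec.allFin m)) ((λ i j eq → trans (sym (lookup∘tabulate id i)) (trans eq (lookup∘tabulate id j))) , []))
    each : ∀ {L} → L ∈ 𝓛 → #extensions L * D ≤ #extensions []
    each {L} L∈ with All.lookup good L∈
    ... | len , diss = subst (λ k → #extensions L * (m ∸ r) ^ k ≤ #extensions []) len
                         (#extensions-bound r L diss (≤-reflexive len))
    open ≤-Reasoning
    few : sum (map (λ E → # E maps) (map (λ L f → does (extends? L f)) 𝓛)) < #extensions []
    few = *-cancelʳ-< D _ _ (begin-strict
      sum (map (λ E → # E maps) (map (λ L f → does (extends? L f)) 𝓛)) * D
        ≡⟨ cong (λ ns → sum ns * D) (sym (map-∘ 𝓛)) ⟩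
      sum (map #extensions 𝓛) * D                  ≡⟨ sum-*ʳ #extensions D 𝓛 ⟩
      sum (map (λ L → #extensions L * D) 𝓛)        ≤⟨ sum-bounded _ (#extensions []) 𝓛 (All.tabulate each) ⟩
      length 𝓛 * #extensions []                    <⟨ *-monoˡ-< (#extensions []) {{>-nonZero identity-extends}} lt ⟩
      D * #extensions []                           ≡⟨ *-comm D _ ⟩
      #extensions [] * D                           ∎)
  ... | f , ext , avoid = f , proj₁ (does-true (extends? [] f) ext) ,
        All.tabulate (λ {L} L∈ sub → does-false (extends? L f) (All.lookup avoid (∈-map⁺ _ L∈))
                                       (proj₁ (does-true (extends? [] f) ext) , sub))

-- Random two-colourings, closures and plucking

all-intro : ∀ (P : A → Bool) xs → (∀ {x} → x ∈ xs → P x ≡ true) → all P xs ≡ true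
all-intro P []       f = refl
all-intro P (x ∷ xs) f = ∧-introᵇ (f (here refl)) (all-intro P xs (f ∘ there))

all-elim : ∀ (P : A → Bool) xs → all P xs ≡ true → ∀ {x} → x ∈ xs → P x ≡ true
all-elim P (x ∷ xs) eq (here refl) = ∧-elimˡ (P x) eq
all-elim P (x ∷ xs) eq (there x∈)  = all-elim P xs (∧-elimʳ (P x) eq) x∈

any-intro : ∀ (P : A → Bool) {x} xs → x ∈ xs → P x ≡ true → any P xs ≡ true
any-intro P (x ∷ xs) (here refl) px rewrite px = refl
any-intro P (x ∷ xs) (there x∈)  px with P x
... | true  = refl
... | false = any-intro P xs x∈ px

any-elim : ∀ (P : A → Bool) xs → any P xs ≡ true → Σ A λ x → x ∈ xs × P x ≡ true
any-elim P (x ∷ xs) eq with P x in px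
... | true  = x , here refl , px
... | false with any-elim P xs eq
...   | y , y∈ , py = y , there y∈ , py

not-intro : ∀ {b} → (b ≡ true → ⊥) → not b ≡ true
not-intro {false} f = refl
not-intro {true}  f = ⊥-elim (f refl)

not-elim : ∀ {b} → not b ≡ true → b ≡ true → ⊥
not-elim {false} _ ()

-- Sequences of length at most `r` replace subsets of size at most `r`: order and repetition inflate
-- the number, but it stays at most (1 + |xs|)^r.
lists : List A → ℕ → List (List A)
lists xs zero    = [] ∷ []
lists xs (suc r) = [] ∷ concatMap (λ x → map (x ∷_) (lists xs r)) xs

∈-lists : ∀ {xs : List A} → (∀ x → x ∈ xs) → ∀ r L → length L ≤ r → L ∈ lists xs r
∈-lists full zero    []      le       = here refl
∈-lists full (suc r) []      le       = here refl
∈-lists full (suc r) (x ∷ L) (s≤s le) =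
  there (∈-concatMap⁺ _ (lose (full x) (∈-map⁺ (x ∷_) (∈-lists full r L le))))

∈-lists⇒length : ∀ (xs : List A) r {L} → L ∈ lists xs r → length L ≤ r
∈-lists⇒length xs zero    (here refl) = z≤n
∈-lists⇒length xs (suc r) (here refl) = z≤n
∈-lists⇒length xs (suc r) (there L∈)  with find (∈-concatMap⁻ (λ x → map (x ∷_) (lists xs r)) {xs = xs} L∈)
... | x , _ , L∈′ with ∈-map⁻ (x ∷_) L∈′
...   | L′ , L′∈ , refl = s≤s (∈-lists⇒length xs r L′∈)

length-concatMap-≤ : ∀ {B : Set} (f : A → List B) b xs → All (λ x → length (f x) ≤ b) xs →
                     length (concatMap f xs) ≤ length xs * b
length-concatMap-≤ f b []       []       = z≤n
length-concatMap-≤ f b (x ∷ xs) (b₁ ∷ bs) = ≤-trans (≤-reflexive (length-++ (f x)))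
  (+-mono-≤ b₁ (length-concatMap-≤ f b xs bs))

length-lists : ∀ (xs : List A) r → length (lists xs r) ≤ suc (length xs) ^ r
length-lists xs zero    = ≤-refl
length-lists xs (suc r) = +-mono-≤ (m^n>0 (suc (length xs)) r)
  (length-concatMap-≤ _ _ xs (All.tabulate (λ {x} _ → ≤-trans (≤-reflexive (length-map (x ∷_) (lists xs r))) (length-lists xs r))))

length-cartesianProduct : ∀ {B : Set} (xs : List A) (ys : List B) →
                          length (cartesianProduct xs ys) ≡ length xs * length ys
length-cartesianProduct []       ys = refl
length-cartesianProduct (x ∷ xs) ys = trans (length-++ (map (x ,_) ys))
  (cong₂ _+_ (length-map (x ,_) ys) (length-cartesianProduct xs ys))

^-distribʳ-* : ∀ a b n → (a * b) ^ n ≡ a ^ n * b ^ n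
^-distribʳ-* a b zero    = refl
^-distribʳ-* a b (suc n) = begin
  a * b * (a * b) ^ n        ≡⟨ cong (a * b *_) (^-distribʳ-* a b n) ⟩
  a * b * (a ^ n * b ^ n)    ≡⟨ *-assoc a b _ ⟩
  a * (b * (a ^ n * b ^ n))  ≡⟨ cong (a *_) (sym (*-assoc b (a ^ n) _)) ⟩
  a * (b * a ^ n * b ^ n)    ≡⟨ cong (λ z → a * (z * b ^ n)) (*-comm b (a ^ n)) ⟩
  a * (a ^ n * b * b ^ n)    ≡⟨ cong (a *_) (*-assoc (a ^ n) b _) ⟩
  a * (a ^ n * (b * b ^ n))  ≡⟨ sym (*-assoc a _ _) ⟩
  a ^ suc n * b ^ suc n      ∎
  where open ≡-Reasoning

-- These are the two leading terms of the binomial expansion of (a + 1)^(k+1).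
bernoulli : ∀ a k → a ^ suc k + suc k * a ^ k ≤ suc a ^ suc k
bernoulli a zero    = ≤-reflexive (trans (cong (_+ 1) (*-identityʳ a)) (trans (+-comm a 1) (sym (*-identityʳ (suc a)))))
bernoulli a (suc k) = begin
  a ^ suc (suc k) + suc (suc k) * a ^ suc k                  ≡⟨ sym (+-assoc (a ^ suc (suc k)) (a ^ suc k) _) ⟩
  a ^ suc (suc k) + a ^ suc k + suc k * a ^ suc k            ≡⟨ cong (_+ suc k * a ^ suc k) (+-comm (a ^ suc (suc k)) _) ⟩
  a ^ suc k + a ^ suc (suc k) + suc k * a ^ suc k            ≡⟨ +-assoc (a ^ suc k) _ _ ⟩
  a ^ suc k + (a ^ suc (suc k) + suc k * a ^ suc k)          ≡⟨ cong (λ z → a ^ suc k + (a ^ suc (suc k) + z)) (swap-factors (suc k) a (a ^ k)) ⟩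
  a ^ suc k + (a * a ^ suc k + a * (suc k * a ^ k))          ≡⟨ cong (a ^ suc k +_) (sym (*-distribˡ-+ a (a ^ suc k) _)) ⟩
  a ^ suc k + a * (a ^ suc k + suc k * a ^ k)                ≤⟨ +-monoˡ-≤ _ (m≤m+n (a ^ suc k) _) ⟩
  suc a * (a ^ suc k + suc k * a ^ k)                        ≤⟨ *-monoʳ-≤ (suc a) (bernoulli a k) ⟩
  suc a ^ suc (suc k)                                        ∎
  where
  open ≤-Reasoning
  swap-factors : ∀ x y z → x * (y * z) ≡ y * (x * z)
  swap-factors x y z = trans (sym (*-assoc x y z)) (trans (cong (_* z) (*-comm x y)) (*-assoc y x z))

-- (1 − 1/N)^(Nq) ≤ 2^(−q), with N = 1 + a.
decay : ∀ a q → 2 ^ q * a ^ (suc a * q) ≤ suc a ^ (suc a * q)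
decay a q = begin
  2 ^ q * a ^ (suc a * q)         ≡⟨ cong (2 ^ q *_) (sym (^-*-assoc a (suc a) q)) ⟩
  2 ^ q * (a ^ suc a) ^ q         ≡⟨ sym (^-distribʳ-* 2 (a ^ suc a) q) ⟩
  (2 * a ^ suc a) ^ q             ≤⟨ ^-monoˡ-≤ q twice ⟩
  (suc a ^ suc a) ^ q             ≡⟨ ^-*-assoc (suc a) (suc a) q ⟩
  suc a ^ (suc a * q)             ∎
  where
  open ≤-Reasoning
  -- The case q = 1, that is (1 - 1/N)^N ≤ 1/2; its q-th power is the claim.
  twice : 2 * a ^ suc a ≤ suc a ^ suc a
  twice = begin
    a ^ suc a + (a ^ suc a + 0)     ≡⟨ cong (a ^ suc a +_) (+-identityʳ _) ⟩
    a ^ suc a + a * a ^ a           ≤⟨ +-monoʳ-≤ (a ^ suc a) (*-monoˡ-≤ (a ^ a) (n≤1+n a)) ⟩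
    a ^ suc a + suc a * a ^ a       ≤⟨ bernoulli a a ⟩
    suc a ^ suc a                   ∎

-- Each index carries the colour of its row and the colour of its column.
Colouring : ℕ → Set
Colouring m = Vec (Bool × Bool) m

colours : List (Bool × Bool)
colours = (false , false) ∷ (true , false) ∷ (false , true) ∷ (true , true) ∷ []

flip₁-colours : map (map₁ not) colours ↭ colours
flip₁-colours = swap _ _ (swap _ _ ↭-refl)

flip₂-colours : map (map₂ not) colours ↭ colours
flip₂-colours = ++-comm ((false , true) ∷ (true , true) ∷ []) ((false , false) ∷ (true , false) ∷ [])

-- Monochromatic edges under random colourings

module _ {m : ℕ} where

  Vertex : Set
  Vertex = Fin m ⊎ Fin m

  _≟ₑ_ : (e e′ : Edge m) → Dec (e ≡ e′)
  _≟ₑ_ = ≡-dec _≟_ _≟_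

  colourings : List (Colouring m)
  colourings = vecs colours m

  flip : Vertex → Colouring m → Colouring m
  flip (inj₁ i) h = updateAt h i (map₁ not)
  flip (inj₂ j) h = updateAt h j (map₂ not)

  #-flip : ∀ v (P : Colouring m → Bool) → # (P ∘ flip v) colourings ≡ # P colourings
  #-flip (inj₁ i) P = #-vecs-updateAt colours _ flip₁-colours i P
  #-flip (inj₂ j) P = #-vecs-updateAt colours _ flip₂-colours j P

  rowColour colColour : Colouring m → Fin m → Bool
  rowColour h i = proj₁ (lookup h i)
  colColour h j = proj₂ (lookup h j)

  mono : Colouring m → Edge m → Bool
  mono h (i , j) = not (rowColour h i xor colColour h j)

  monos : Colouring m → List (Edge m) → Bool
  monos h = all (mono h)

  Incident : Edge m → Vertex → Set
  Incident (i , j) v = v ≡ inj₁ i ⊎ v ≡ inj₂ j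

  colColour-flip₁ : ∀ i h j → colColour (flip (inj₁ i) h) j ≡ colColour h j
  colColour-flip₁ i h j with j ≟ i
  ... | yes refl = cong proj₂ (lookup∘updateAt i h)
  ... | no  j≢i  = cong proj₂ (lookup∘updateAt′ j i j≢i h)

  rowColour-flip₂ : ∀ j h i → rowColour (flip (inj₂ j) h) i ≡ rowColour h i
  rowColour-flip₂ j h i with i ≟ j
  ... | yes refl = cong proj₁ (lookup∘updateAt j h)
  ... | no  i≢j  = cong proj₁ (lookup∘updateAt′ i j i≢j h)

  mono-flip-incident : ∀ e v → Incident e v → ∀ h → mono (flip v h) e ≡ not (mono h e)
  mono-flip-incident (i , j) _ (inj₁ refl) h = cong not (trans
    (cong₂ _xor_ (cong proj₁ (lookup∘updateAt i h)) (colColour-flip₁ i h j))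
    (sym (not-distribˡ-xor (rowColour h i) _)))
  mono-flip-incident (i , j) _ (inj₂ refl) h = cong not (trans
    (cong₂ _xor_ (rowColour-flip₂ j h i) (cong proj₂ (lookup∘updateAt j h)))
    (sym (not-distribʳ-xor (rowColour h i) _)))

  mono-flip-other : ∀ e v → ¬ Incident e v → ∀ h → mono (flip v h) e ≡ mono h e
  mono-flip-other (i , j) (inj₁ k) ¬inc h = cong not (cong₂ _xor_
    (cong proj₁ (lookup∘updateAt′ i k (λ eq → ¬inc (inj₁ (cong inj₁ (sym eq)))) h)) (colColour-flip₁ k h j))
  mono-flip-other (i , j) (inj₂ k) ¬inc h = cong not (cong₂ _xor_
    (rowColour-flip₂ k h i) (cong proj₂ (lookup∘updateAt′ j k (λ eq → ¬inc (inj₂ (cong inj₂ (sym eq)))) h)))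

  -- Says that `X` is determined by the colours at the endpoints of `Z`, phrased as invariance under
  -- recolouring any other vertex.
  DependsOn : (Colouring m → Bool) → List (Edge m) → Set
  DependsOn X Z = ∀ v → (∀ {e} → e ∈ Z → ¬ Incident e v) → ∀ h → X (flip v h) ≡ X h

  dependsOn-monos : ∀ A → DependsOn (λ h → monos h A) A
  dependsOn-monos []      v away h = refl
  dependsOn-monos (e ∷ A) v away h =
    cong₂ _∧_ (mono-flip-other e v (away (here refl)) h) (dependsOn-monos A v (away ∘ there) h)

  dependsOn-∧ : ∀ {X Y Z₁ Z₂} → DependsOn X Z₁ → DependsOn Y Z₂ → DependsOn (λ h → X h ∧ Y h) (Z₁ ++ Z₂)
  dependsOn-∧ {Z₁ = Z₁} dX dY v away h =
    cong₂ _∧_ (dX v (away ∘ ∈-++⁺ˡ) h) (dY v (away ∘ ∈-++⁺ʳ Z₁) h)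

  -- One endpoint outside `Z` suffices: its colour alone makes the edge monochromatic with
  -- probability 1/2, independently of every event that depends on `Z`.
  Fresh : List (Edge m) → Edge m → Set
  Fresh Z (i , j) = i ∉ map proj₁ Z ⊎ j ∉ map proj₂ Z

  fresh-vertex : ∀ {Z e} → Fresh Z e → Σ Vertex λ v → Incident e v × (∀ {e′} → e′ ∈ Z → ¬ Incident e′ v)
  fresh-vertex {e = i , j} (inj₁ i∉) = inj₁ i , inj₁ refl , λ { e′∈ (inj₁ refl) → i∉ (∈-map⁺ proj₁ e′∈) }
  fresh-vertex {e = i , j} (inj₂ j∉) = inj₂ j , inj₂ refl , λ { e′∈ (inj₂ refl) → j∉ (∈-map⁺ proj₂ e′∈) }

  -- Lists stand for edge sets, so a matching may repeat an edge.
  Compatible : Edge m → Edge m → Set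
  Compatible e e′ = e ≡ e′ ⊎ Disjoint e e′

  Matching : List (Edge m) → Set
  Matching = AllPairs Compatible

  fresh-∷ : ∀ {Z e e′} → Disjoint e e′ → Fresh Z e′ → Fresh (e ∷ Z) e′
  fresh-∷ (i≢ , j≢) (inj₁ i∉) = inj₁ λ { (here eq) → i≢ (sym eq) ; (there i∈) → i∉ i∈ }
  fresh-∷ (i≢ , j≢) (inj₂ j∉) = inj₂ λ { (here eq) → j≢ (sym eq) ; (there j∈) → j∉ j∈ }

  -- The flip at `v` exchanges `X ∧ Y` with `X ∧ not Y`, so `Y` holds on exactly half of `X`.
  #-toggle : ∀ v (X Y : Colouring m → Bool) → (∀ h → X (flip v h) ≡ X h) → (∀ h → Y (flip v h) ≡ not (Y h)) →
             # X colourings ≤ 2 * # (λ h → X h ∧ Y h) colourings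
  #-toggle v X Y keep toggle = ≤-reflexive (begin
    # X colourings                                           ≡⟨ #-split X Y colourings ⟩
    # XY colourings + # (λ h → X h ∧ not (Y h)) colourings   ≡⟨ cong (# XY colourings +_) (#-cong toggled colourings) ⟩
    # XY colourings + # (XY ∘ flip v) colourings             ≡⟨ cong (# XY colourings +_) (#-flip v XY) ⟩
    # XY colourings + # XY colourings                        ≡⟨ cong (# XY colourings +_) (sym (+-identityʳ _)) ⟩
    2 * # XY colourings                                      ∎)
    where
    open ≡-Reasoning
    XY : Colouring m → Bool
    XY h = X h ∧ Y h
    toggled : ∀ h → X h ∧ not (Y h) ≡ XY (flip v h)
    toggled h = sym (cong₂ _∧_ (keep h) (toggle h))

  -- The edges of `A` are imposed one by one, each at worst halving the count: an edge forced by `X`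
  -- costs nothing and a fresh one is a fair coin. Since `A` is a matching, later fresh edges stay
  -- fresh once `e` has joined `Z`, or repeat `e` and are then forced.
  spread : ∀ X Z A → DependsOn X Z → Matching A →
           All (λ e → X ⇛ (λ h → mono h e) ⊎ Fresh Z e) A →
           # X colourings ≤ 2 ^ length A * # (λ h → X h ∧ monos h A) colourings
  spread X Z []      dep _           _        = ≤-trans (#-mono (λ h x → ∧-introᵇ x refl) colourings) (≤-reflexive (sym (*-identityˡ _)))
  spread X Z (e ∷ A) dep (cs ∷ mat) (s ∷ ss) = begin
    # X colourings                                                          ≤⟨ first s ⟩
    2 * # Xe colourings                                                     ≤⟨ *-monoʳ-≤ 2 (spread Xe (e ∷ Z) A depe mat (All.tabulate later)) ⟩
    2 * (2 ^ length A * # (λ h → Xe h ∧ monos h A) colourings)              ≡⟨ sym (*-assoc 2 (2 ^ length A) _) ⟩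
    2 ^ length (e ∷ A) * # (λ h → Xe h ∧ monos h A) colourings              ≡⟨ cong (2 ^ length (e ∷ A) *_) (#-cong (λ h → ∧-assoc (X h) _ _) colourings) ⟩
    2 ^ length (e ∷ A) * # (λ h → X h ∧ monos h (e ∷ A)) colourings         ∎
    where
    open ≤-Reasoning
    Xe : Colouring m → Bool
    Xe h = X h ∧ mono h e
    first : X ⇛ (λ h → mono h e) ⊎ Fresh Z e → # X colourings ≤ 2 * # Xe colourings
    first (inj₁ imp) = ≤-trans (#-mono (λ h x → ∧-introᵇ x (imp h x)) colourings) (m≤m+n _ _)
    first (inj₂ fr) with fresh-vertex {Z} {e} fr
    ... | v , inc , away = #-toggle v X (λ h → mono h e) (dep v away) (mono-flip-incident e v inc)
    depe : DependsOn Xe (e ∷ Z)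
    depe v away h = cong₂ _∧_ (dep v (away ∘ there) h) (mono-flip-other e v (away (here refl)) h)
    later : ∀ {e′} → e′ ∈ A → Xe ⇛ (λ h → mono h e′) ⊎ Fresh (e ∷ Z) e′
    later e′∈ with All.lookup cs e′∈ | All.lookup ss e′∈
    ... | inj₁ refl | _         = inj₁ (λ h → ∧-elimʳ (X h))
    ... | inj₂ _    | inj₁ imp  = inj₁ (λ h eq → imp h (∧-elimˡ (X h) eq))
    ... | inj₂ dis  | inj₂ fr   = inj₂ (fresh-∷ {Z} dis fr)

-- Approximating families, their closure and plucking

module Approximation (m r q : ℕ) where

  open DecMembership (_≟ₑ_ {m}) using () renaming (_∈?_ to _∈ₑ?_)
  open DecMembership (_≟_ {m}) using (_∈?_)

  edges : List (Edge m)
  edges = cartesianProduct (allFin m) (allFin m)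

  smallSets : List (List (Edge m))
  smallSets = lists edges r

  ∈-smallSets : ∀ A → length A ≤ r → A ∈ smallSets
  ∈-smallSets = ∈-lists (λ _ → ∈-cartesianProduct⁺ (∈-allFin _) (∈-allFin _)) r

  Family : Set
  Family = List (Edge m) → Bool

  accepts : Family → Colouring m → Bool
  accepts W h = any (λ A → W A ∧ monos h A) smallSets

  uncovered : Family → List (Edge m) → Colouring m → Bool
  uncovered W B h = monos h B ∧ not (accepts W h)

  total : ℕ
  total = length (colourings {m})

  closure : Family → Family
  closure W B = does (# (uncovered W B) colourings * 2 ^ q ≤? total)

  -- Each petal leaves at most the fraction 1 - 2^(-r) of the colourings still in play, so 2^r · q
  -- petals leave at most 2^(-q). `core` bounds the edges of `B` and of all petals together, each of
  -- these sets having size at most `r`.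
  petals core : ℕ
  petals = 2 ^ r * q
  core   = r + petals * r

  Fresh? : ∀ Z (e : Edge m) → Dec (Fresh Z e)
  Fresh? Z (i , j) = ¬? (i ∈? map proj₁ Z) ⊎-dec ¬? (j ∈? map proj₂ Z)

  module _ (W : Family) (B : List (Edge m)) (¬cl : closure W B ≡ false) where

    Hit : List (Edge m) → Set
    Hit E = ∀ A → length A ≤ r → W A ≡ true → Matching A → Σ (Edge m) λ e → e ∈ A × e ∈ E × e ∉ B

    -- A member of `W` that is still likely to be monochromatic once `B` is: its edges lie in `B` or
    -- are fair coins relative to `Z`. This replaces the disjoint petals of a sunflower.
    Petal : List (Edge m) → List (Edge m) → Set
    Petal Z A = W A ≡ true × Matching A × All (λ e → e ∈ B ⊎ Fresh Z e) A

    Petal? : ∀ Z A → Dec (Petal Z A)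
    Petal? Z A = (W A Bool.≟ true) ×-dec allPairs? (λ e e′ → (e ≟ₑ e′) ⊎-dec (¬? (proj₁ e ≟ proj₁ e′) ×-dec ¬? (proj₂ e ≟ proj₂ e′))) A
                 ×-dec All.all? (λ e → (e ∈ₑ? B) ⊎-dec Fresh? Z e) A

    -- Without a petal, every small matching in `W` has an edge outside `B` that is not fresh. Both
    -- endpoints of it occur in `Z`, so it lies in the product of the rows and the columns of `Z`.
    maximal-hit : ∀ Z → ¬ Any (Petal Z) smallSets → Hit (cartesianProduct (map proj₁ Z) (map proj₂ Z))
    maximal-hit Z none A len wA mat
      with find (All.¬All⇒Any¬ (λ e → (e ∈ₑ? B) ⊎-dec Fresh? Z e) A (λ fr → none (lose (∈-smallSets A len) (wA , mat , fr))))
    ... | (i , j) , e∈ , ¬fr with i ∈? map proj₁ Z | j ∈? map proj₂ Z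
    ...   | yes i∈ | yes j∈ = (i , j) , e∈ , ∈-cartesianProduct⁺ i∈ j∈ , λ e∈B → ¬fr (inj₁ e∈B)
    ...   | no  i∉ | _      = ⊥-elim (¬fr (inj₂ (inj₁ i∉)))
    ...   | yes _  | no  j∉ = ⊥-elim (¬fr (inj₂ (inj₂ j∉)))

    N-1 : ℕ
    N-1 = 2 ^ r ∸ 1

    suc-N-1 : suc N-1 ≡ 2 ^ r
    suc-N-1 = m+[n∸m]≡n (m^n>0 2 r)

    -- On `Q`, which makes `B` monochromatic, `spread` gives `A` monochromatic with probability at
    -- least 2^(-r). Adding `# Q colourings` to both sides avoids subtraction.
    few-survive : ∀ Q Z A → DependsOn Q Z → length A ≤ r → Q ⇛ (λ h → monos h B) → Petal Z A →
                  # (λ h → Q h ∧ not (monos h A)) colourings * suc N-1 ≤ N-1 * # Q colourings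
    few-survive Q Z A dep len QB (_ , mat , fr) = +-cancelʳ-≤ (# Q colourings) _ _ (begin
      b * suc N-1 + # Q colourings             ≤⟨ +-monoʳ-≤ (b * suc N-1) hits ⟩
      b * suc N-1 + suc N-1 * a                ≡⟨ cong (_+ suc N-1 * a) (*-comm b _) ⟩
      suc N-1 * b + suc N-1 * a                ≡⟨ +-comm (suc N-1 * b) _ ⟩
      suc N-1 * a + suc N-1 * b                ≡⟨ sym (*-distribˡ-+ (suc N-1) a b) ⟩
      suc N-1 * (a + b)                        ≡⟨ cong (suc N-1 *_) (sym (#-split Q (λ h → monos h A) colourings)) ⟩
      # Q colourings + N-1 * # Q colourings    ≡⟨ +-comm (# Q colourings) _ ⟩
      N-1 * # Q colourings + # Q colourings    ∎)
      where
      open ≤-Reasoning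
      a b : ℕ
      a = # (λ h → Q h ∧ monos h A) colourings
      b = # (λ h → Q h ∧ not (monos h A)) colourings
      implied-or-fresh : ∀ {e} → e ∈ B ⊎ Fresh Z e → Q ⇛ (λ h → mono h e) ⊎ Fresh Z e
      implied-or-fresh (inj₁ e∈) = inj₁ (λ h q → all-elim (mono h) B (QB h q) e∈)
      implied-or-fresh (inj₂ fr) = inj₂ fr
      hits : # Q colourings ≤ suc N-1 * a
      hits = begin
        # Q colourings      ≤⟨ spread Q Z A dep mat (All.map implied-or-fresh fr) ⟩
        2 ^ length A * a    ≤⟨ *-monoˡ-≤ a (^-monoʳ-≤ 2 len) ⟩
        2 ^ r * a           ≡⟨ cong (_* a) (sym suc-N-1) ⟩
        suc N-1 * a         ∎

    -- Once all petals are used up, `decay` brings `Q`, and with it the uncovered colourings, within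
    -- the threshold of the closure, although `B` is missing from it.
    exhausted : ∀ Q → uncovered W B ⇛ Q → # Q colourings * suc N-1 ^ petals ≤ N-1 ^ petals * total → ⊥
    exhausted Q UQ bound = does-false (# (uncovered W B) colourings * 2 ^ q ≤? total) ¬cl
      (*-cancelʳ-≤ _ _ (suc N-1 ^ petals) {{>-nonZero (m^n>0 (suc N-1) petals)}} (begin
        # (uncovered W B) colourings * 2 ^ q * suc N-1 ^ petals   ≤⟨ *-monoˡ-≤ _ (*-monoˡ-≤ (2 ^ q) (#-mono UQ colourings)) ⟩
        # Q colourings * 2 ^ q * suc N-1 ^ petals                 ≡⟨ cong (_* suc N-1 ^ petals) (*-comm (# Q colourings) _) ⟩
        2 ^ q * # Q colourings * suc N-1 ^ petals                 ≡⟨ *-assoc (2 ^ q) _ _ ⟩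
        2 ^ q * (# Q colourings * suc N-1 ^ petals)               ≤⟨ *-monoʳ-≤ (2 ^ q) bound ⟩
        2 ^ q * (N-1 ^ petals * total)                            ≡⟨ sym (*-assoc (2 ^ q) _ _) ⟩
        2 ^ q * N-1 ^ petals * total                              ≤⟨ *-monoˡ-≤ total decay′ ⟩
        suc N-1 ^ petals * total                                  ≡⟨ *-comm _ total ⟩
        total * suc N-1 ^ petals                                  ∎))
      where
      open ≤-Reasoning
      decay′ : 2 ^ q * N-1 ^ petals ≤ suc N-1 ^ petals
      decay′ = subst (λ N → 2 ^ q * N-1 ^ (N * q) ≤ suc N-1 ^ (N * q)) suc-N-1 (decay N-1 q)

    -- Petals are collected greedily. `Q` says that `B` is monochromatic and none of the `s` chosen
    -- petals is; no uncovered colouring is ever discarded, as it makes no small member of `W`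
    -- monochromatic. `Z` holds the edges of `B` and of the chosen petals.
    greedy : ∀ fuel s Z Q → fuel + s ≡ petals → DependsOn Q Z → Q ⇛ (λ h → monos h B) → uncovered W B ⇛ Q →
             # Q colourings * suc N-1 ^ s ≤ N-1 ^ s * total → length Z ≤ r + s * r →
             Σ (List (Edge m)) λ Z′ → length Z′ ≤ core × ¬ Any (Petal Z′) smallSets
    greedy zero       s Z Q refl dep QB UQ bound len = ⊥-elim (exhausted Q UQ bound)
    greedy (suc fuel) s Z Q eq   dep QB UQ bound len with Any.any? (Petal? Z) smallSets
    ... | no  none  = Z , ≤-trans len (+-monoʳ-≤ r (*-monoˡ-≤ r (≤-trans (m≤n+m s (suc fuel)) (≤-reflexive eq)))) , none
    ... | yes found with find found
    ...   | A , A∈ , petal = greedy fuel (suc s) (Z ++ A) Q′ (trans (+-suc fuel s) eq) dep′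
              (λ h q → QB h (∧-elimˡ (Q h) q)) UQ′ bound′ len′
      where
      open ≤-Reasoning
      lenA : length A ≤ r
      lenA = ∈-lists⇒length edges r A∈
      Q′ : Colouring m → Bool
      Q′ h = Q h ∧ not (monos h A)
      dep′ : DependsOn Q′ (Z ++ A)
      dep′ = dependsOn-∧ {X = Q} {Z₁ = Z} dep (λ v away h → cong not (dependsOn-monos A v away h))
      UQ′ : uncovered W B ⇛ Q′
      UQ′ h u = ∧-introᵇ (UQ h u) (not-intro λ ma →
        not-elim (∧-elimʳ (monos h B) u) (any-intro (λ A → W A ∧ monos h A) smallSets A∈ (∧-introᵇ (proj₁ petal) ma)))
      bound′ : # Q′ colourings * suc N-1 ^ suc s ≤ N-1 ^ suc s * total
      bound′ = begin
        # Q′ colourings * (suc N-1 * suc N-1 ^ s)    ≡⟨ sym (*-assoc (# Q′ colourings) _ _) ⟩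
        # Q′ colourings * suc N-1 * suc N-1 ^ s      ≤⟨ *-monoˡ-≤ _ (few-survive Q Z A dep lenA QB petal) ⟩
        N-1 * # Q colourings * suc N-1 ^ s           ≡⟨ *-assoc N-1 _ _ ⟩
        N-1 * (# Q colourings * suc N-1 ^ s)         ≤⟨ *-monoʳ-≤ N-1 bound ⟩
        N-1 * (N-1 ^ s * total)                      ≡⟨ sym (*-assoc N-1 _ _) ⟩
        N-1 ^ suc s * total                          ∎
      len′ : length (Z ++ A) ≤ r + suc s * r
      len′ = begin
        length (Z ++ A)         ≡⟨ length-++ Z ⟩
        length Z + length A     ≤⟨ +-mono-≤ len lenA ⟩
        r + s * r + r           ≡⟨ +-assoc r _ _ ⟩
        r + (s * r + r)         ≡⟨ cong (r +_) (+-comm (s * r) r) ⟩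
        r + suc s * r           ∎

    pluck : length B ≤ r → Σ (List (Edge m)) λ E → length E ≤ core * core × Hit E
    pluck lenB with greedy petals 0 B (λ h → monos h B) (+-identityʳ petals) (dependsOn-monos B) (λ h q → q)
                      (λ h → ∧-elimˡ (monos h B)) start (≤-trans lenB (m≤m+n r 0))
      where
      start : # (λ h → monos h B) colourings * 1 ≤ 1 * total
      start = ≤-trans (≤-reflexive (*-identityʳ _)) (≤-trans (#-≤-length (λ h → monos h B) (colourings {m})) (≤-reflexive (sym (*-identityˡ total))))
    ... | Z , len , none = cartesianProduct (map proj₁ Z) (map proj₂ Z) , square , maximal-hit Z none
      where
      square : length (cartesianProduct (map proj₁ Z) (map proj₂ Z)) ≤ core * core
      square = ≤-trans (≤-reflexive (trans (length-cartesianProduct (map proj₁ Z) (map proj₂ Z)) (cong₂ _*_ (length-map proj₁ Z) (length-map proj₂ Z)))) (*-mono-≤ len len)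

-- Monotone networks

concatMap-All⁺ : ∀ {A B : Set} {P : B → Set} (f : A → List B) xs → (∀ {x} → x ∈ xs → All P (f x)) → All P (concatMap f xs)
concatMap-All⁺ f []       ps = []
concatMap-All⁺ f (x ∷ xs) ps = All.++⁺ (ps (here refl)) (concatMap-All⁺ f xs (ps ∘ there))

concatMap-All⁻ : ∀ {A B : Set} {P : B → Set} (f : A → List B) xs → All P (concatMap f xs) → ∀ {x} → x ∈ xs → All P (f x)
concatMap-All⁻ f xs ps x∈ = All.lookup (All.map⁻ (All.concat⁻ {xss = map f xs} ps)) x∈

-- Parity: odd colourings admit no perfect matching

xorSum : List Bool → Bool
xorSum = foldr _xor_ false

xor-interchange : ∀ a b c d → (a xor b) xor (c xor d) ≡ (a xor c) xor (b xor d)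
xor-interchange a b c d = begin
  (a xor b) xor (c xor d) ≡⟨ xor-assoc a b _ ⟩
  a xor (b xor (c xor d)) ≡⟨ cong (a xor_) (sym (xor-assoc b c d)) ⟩
  a xor ((b xor c) xor d) ≡⟨ cong (λ z → a xor (z xor d)) (xor-comm b c) ⟩
  a xor ((c xor b) xor d) ≡⟨ cong (a xor_) (xor-assoc c b d) ⟩
  a xor (c xor (b xor d)) ≡⟨ sym (xor-assoc a c _) ⟩
  (a xor c) xor (b xor d) ∎
  where open ≡-Reasoning

xorSum-↭ : ∀ {as bs} → as ↭ bs → xorSum as ≡ xorSum bs
xorSum-↭ ↭.refl                = refl
xorSum-↭ (↭.prep a as↭bs)      = cong (a xor_) (xorSum-↭ as↭bs)
xorSum-↭ (↭.swap a b as↭bs)    = trans (cong (λ z → a xor (b xor z)) (xorSum-↭ as↭bs))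
  (trans (sym (xor-assoc a b _)) (trans (cong (_xor _) (xor-comm a b)) (xor-assoc b a _)))
xorSum-↭ (↭.trans as↭bs bs↭cs) = trans (xorSum-↭ as↭bs) (xorSum-↭ bs↭cs)

odd : ∀ {n} → Vec (Bool × Bool) n → Bool
odd []            = false
odd ((a , b) ∷ h) = (a xor b) xor odd h

odd-flip : ∀ {n} (h : Vec (Bool × Bool) n) i → odd (updateAt h i (map₁ not)) ≡ not (odd h)
odd-flip ((a , b) ∷ h) zero    = trans (cong (_xor odd h) (sym (not-distribˡ-xor a b))) (sym (not-distribˡ-xor (a xor b) (odd h)))
odd-flip ((a , b) ∷ h) (suc i) = trans (cong ((a xor b) xor_) (odd-flip h i)) (sym (not-distribʳ-xor (a xor b) (odd h)))

odd-split : ∀ {n} (h : Vec (Bool × Bool) n) →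
            odd h ≡ xorSum (tabulate (λ i → proj₁ (lookup h i))) xor xorSum (tabulate (λ j → proj₂ (lookup h j)))
odd-split []            = refl
odd-split ((a , b) ∷ h) = trans (cong ((a xor b) xor_) (odd-split h)) (xor-interchange a b _ _)

mono-equal : ∀ a b → not (a xor b) ≡ true → a ≡ b
mono-equal false false _ = refl
mono-equal true  true  _ = refl

-- A perfect matching of monochromatic edges carries the row colours bijectively to the column
-- colours, so the two parities agree and cancel.
odd-unmatchable : ∀ {m} (h : Colouring m) (f : Vec (Fin m) m) → IsInj f →
                  (∀ i → mono h (i , lookup f i) ≡ true) → odd h ≡ false
odd-unmatchable {m} h f inj matched = begin
  odd h                                                      ≡⟨ odd-split h ⟩
  xorSum (tabulate (rowColour h)) xor xorSum (tabulate col)  ≡⟨ cong (_xor xorSum (tabulate col)) rows≡cols ⟩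
  xorSum (tabulate col) xor xorSum (tabulate col)            ≡⟨ xor-same (xorSum (tabulate col)) ⟩
  false                                                      ∎
  where
  open ≡-Reasoning
  col : Fin m → Bool
  col = colColour h
  rows≡cols : xorSum (tabulate (rowColour h)) ≡ xorSum (tabulate col)
  rows≡cols = begin
    xorSum (tabulate (rowColour h))                 ≡⟨ cong xorSum (sym (map-tabulate id (rowColour h))) ⟩
    xorSum (map (rowColour h) (allFin m))           ≡⟨ cong xorSum (map-cong (λ i → mono-equal _ _ (matched i)) (allFin m)) ⟩
    xorSum (map (col ∘ lookup f) (allFin m))        ≡⟨ cong xorSum (map-∘ (allFin m)) ⟩
    xorSum (map col (map (lookup f) (allFin m)))    ≡⟨ xorSum-↭ (map⁺ col (injective-allFin-↭ (lookup f) (λ {i} {j} → inj i j))) ⟩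
    xorSum (map col (allFin m))                     ≡⟨ cong xorSum (map-tabulate id col) ⟩
    xorSum (tabulate col)                           ∎

module _ {m : ℕ} where

  fresh-row : ∀ (A : List (Edge m)) → length A < m → Σ (Fin m) λ i → i ∉ map proj₁ A
  fresh-row A lt with filter free? (allFin m) in eq | length-filter-∉ (map proj₁ A)
    where free? = λ i → ¬? (DecMembership._∈?_ _≟_ i (map proj₁ A))
  ... | []    | le = ⊥-elim (<⇒≱ lt (≤-trans le (≤-reflexive (length-map proj₁ A))))
  ... | i ∷ _ | _  = i , proj₂ (∈-filter⁻ (λ i → ¬? (DecMembership._∈?_ _≟_ i (map proj₁ A))) {xs = allFin m}
                                  (subst (i ∈_) (sym eq) (here refl)))

  -- `A` is monochromatic with probability at least 2^(-|A|). Flipping a row untouched by `A`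
  -- switches the parity and leaves `A` as it is, which costs one more factor 2.
  many-odd : ∀ A → Matching A → length A < m →
             length (colourings {m}) ≤ 2 ^ suc (length A) * # (λ h → monos h A ∧ odd h) colourings
  many-odd A mat lt with fresh-row A lt
  ... | i , i∉ = begin
    length (colourings {m})                                     ≤⟨ length-# (colourings {m}) ⟩
    # (λ h → true) (colourings {m})                             ≤⟨ spread (λ h → true) [] A (λ _ _ _ → refl) mat (All.tabulate (λ _ → inj₂ (inj₁ λ ()))) ⟩
    2 ^ length A * # (λ h → monos h A) colourings               ≤⟨ *-monoʳ-≤ (2 ^ length A) (#-toggle (inj₁ i) (λ h → monos h A) odd
                                                                     (dependsOn-monos A (inj₁ i) away) (λ h → odd-flip h i)) ⟩
    2 ^ length A * (2 * oddA)                                   ≡⟨ sym (*-assoc (2 ^ length A) 2 _) ⟩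
    2 ^ length A * 2 * oddA                                     ≡⟨ cong (_* oddA) (*-comm (2 ^ length A) 2) ⟩
    2 ^ suc (length A) * oddA                                   ∎
    where
    open ≤-Reasoning
    oddA : ℕ
    oddA = # (λ h → monos h A ∧ odd h) colourings
    length-# : ∀ {X : Set} (xs : List X) → length xs ≤ # (λ _ → true) xs
    length-# []       = z≤n
    length-# (x ∷ xs) = s≤s (length-# xs)
    away : ∀ {e} → e ∈ A → ¬ Incident e (inj₁ i)
    away e∈ (inj₁ refl) = i∉ (∈-map⁺ proj₁ e∈)

  colourings-nonempty : 1 ≤ length (colourings {m})
  colourings-nonempty = ≤-trans (#-witness (λ _ → true) (colourings {m}) (∈-vecs full (Vec.replicate m (false , false))) refl)
                                (#-≤-length (λ _ → true) (colourings {m}))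
    where
    full : ∀ a → a ∈ colours
    full (false , false) = here refl
    full (true  , false) = there (here refl)
    full (false , true)  = there (there (here refl))
    full (true  , true)  = there (there (there (here refl)))

  graph-compatible : ∀ (f : Vec (Fin m) m) → IsInj f → ∀ {e e′} → f ∋ e → f ∋ e′ → Compatible e e′
  graph-compatible f inj {i , j} {i′ , j′} fi fi′ with i ≟ i′
  ... | yes refl = inj₁ (cong (i ,_) (trans (sym fi) fi′))
  ... | no  i≢i′ = inj₂ (i≢i′ , λ j≡j′ → i≢i′ (inj i i′ (trans fi (trans j≡j′ (sym fi′)))))

  graph-matching : ∀ (f : Vec (Fin m) m) → IsInj f → ∀ {A} → All (f ∋_) A → Matching A
  graph-matching f inj []        = []
  graph-matching f inj (fe ∷ fA) = All.map (graph-compatible f inj fe) fA ∷ graph-matching f inj fA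

-- Approximated networks: lost matchings and false acceptances

module LowerBound (m r q : ℕ) where

  open Approximation m r q

  width : ℕ
  width = core * core

  meet : List Family → Family
  meet Ws B = all (λ W → closure W B) Ws

  AcceptsMap : Vec (Fin m) m → Family → Set
  AcceptsMap f W = Σ (List (Edge m)) λ A → length A ≤ r × W A ≡ true × All (f ∋_) A

  -- The shape to which `injection-avoiding` applies.
  Lost : List (List (Edge m)) → Set
  Lost = All (λ L → length L ≡ suc r × AllPairs Disjoint L)

  Avoids : Vec (Fin m) m → List (List (Edge m)) → Set
  Avoids f = All (λ L → ¬ All (f ∋_) L)

  -- If B is missing from some closure, every injection containing B accepted there contains one of
  -- at most `width` further edges: branch on them until the size exceeds r.
  meet-loss : ∀ Ws d B → d + length B ≡ suc r → AllPairs Disjoint B →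
              Σ (List (List (Edge m))) λ 𝓛 → length 𝓛 ≤ width ^ d × Lost 𝓛 ×
              (∀ f → IsInj f → All (f ∋_) B → Avoids f 𝓛 → All (AcceptsMap f) Ws → AcceptsMap f (meet Ws))
  meet-loss Ws zero    B len dis =
    -- The branch has reached size r + 1; the injections through `B` are given up.
    B ∷ [] , ≤-refl , (len , dis) ∷ [] , λ { f inj fB (¬fB ∷ []) _ → ⊥-elim (¬fB fB) }
  meet-loss Ws (suc d) B len dis with Any.any? (λ W → closure W B Bool.≟ false) Ws
  -- `B` lies in every closure and is small, so it is itself the witness in the meet.
  ... | no  none = [] , z≤n , [] , λ f inj fB _ _ → B , lenB , all-intro _ Ws (λ W∈ → closed W∈) , fB
    where
    lenB : length B ≤ r
    lenB = ≤-trans (m≤n+m (length B) d) (≤-reflexive (suc-injective len))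
    closed : ∀ {W} → W ∈ Ws → closure W B ≡ true
    closed {W} W∈ with closure W B in eq
    ... | true  = refl
    ... | false = ⊥-elim (none (lose W∈ eq))
  ... | yes found with find found
  ...   | W , W∈ , ¬cl = finish (pluck W B ¬cl lenB)
    where
    lenB : length B ≤ r
    lenB = ≤-trans (m≤n+m (length B) d) (≤-reflexive (suc-injective len))
    branch : ∀ E → Σ (List (List (Edge m))) λ 𝓛 → length 𝓛 ≤ length E * width ^ d × Lost 𝓛 ×
             (∀ f → IsInj f → All (f ∋_) B → Avoids f 𝓛 → All (AcceptsMap f) Ws →
              Any (λ e → f ∋ e × e ∉ B) E → AcceptsMap f (meet Ws))
    branch []      = [] , z≤n , [] , λ _ _ _ _ _ ()
    branch (e ∷ E) with branch E | All.all? (λ e′ → ¬? (proj₁ e ≟ proj₁ e′) ×-dec ¬? (proj₂ e ≟ proj₂ e′)) B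
    -- An edge outside `B` that shares a row or column with an edge of `B` is in no injection
    -- together with `B`, so no branch is opened.
    ... | 𝓛 , len𝓛 , lost , accept | no  ¬dis = 𝓛 , ≤-trans len𝓛 (m≤n+m _ (width ^ d)) , lost , λ
      { f inj fB av acc (here (fe , e∉)) → ⊥-elim (¬dis (All.tabulate λ e′∈ →
          disjoint (λ { refl → e∉ e′∈ }) (graph-compatible f inj fe (All.lookup fB e′∈))))
      ; f inj fB av acc (there hit)      → accept f inj fB av acc hit }
      where
      disjoint : ∀ {e e′ : Edge m} → e ≢ e′ → Compatible e e′ → Disjoint e e′
      disjoint ne (inj₁ eq)  = ⊥-elim (ne eq)
      disjoint ne (inj₂ dis) = dis
    ... | 𝓛 , len𝓛 , lost , accept | yes e-dis with meet-loss Ws d (e ∷ B) (trans (+-suc d (length B)) len) (e-dis ∷ dis)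
    ...   | 𝓛′ , len𝓛′ , lost′ , accept′ =
      𝓛′ ++ 𝓛 , ≤-trans (≤-reflexive (length-++ 𝓛′)) (+-mono-≤ len𝓛′ len𝓛) , All.++⁺ lost′ lost , λ
      { f inj fB av acc (here (fe , _)) → accept′ f inj (fe ∷ fB) (All.++⁻ˡ 𝓛′ av) acc
      ; f inj fB av acc (there hit)     → accept f inj fB (All.++⁻ʳ 𝓛′ av) acc hit }
    finish : Σ (List (Edge m)) (λ E → length E ≤ width × Hit W B ¬cl E) →
             Σ (List (List (Edge m))) λ 𝓛 → length 𝓛 ≤ width ^ suc d × Lost 𝓛 ×
             (∀ f → IsInj f → All (f ∋_) B → Avoids f 𝓛 → All (AcceptsMap f) Ws → AcceptsMap f (meet Ws))
    finish (E , lenE , hit) with branch E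
    ... | 𝓛 , len𝓛 , lost , accept = 𝓛 , ≤-trans len𝓛 (*-monoˡ-≤ (width ^ d) lenE) , lost , λ f inj fB av acc →
      accept f inj fB av acc (edge-hit f inj (All.lookup acc W∈))
      where
      edge-hit : ∀ f → IsInj f → AcceptsMap f W → Any (λ e → f ∋ e × e ∉ B) E
      edge-hit f inj (A , lenA , wA , fA) with hit A lenA wA (graph-matching f inj fA)
      ... | e , e∈A , e∈E , e∉B = lose e∈E (All.lookup fA e∈A , e∉B)

  module Network {I : Set} (input : I → Maybe (Edge m)) (rules : I → List (List I)) where

    -- In `rules x` each inner list is an OR, and the outer list is their AND.
    value : (Edge m → Bool) → ℕ → I → Bool
    value G zero    x = maybe′ G true (input x)
    value G (suc s) x = all (any (value G s)) (rules x)

    open DecMembership (_≟ₑ_ {m}) using () renaming (_∈?_ to _∈ₑ?_)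

    -- `join` is the plain union and `meet` intersects the closures, so each OR gets a single
    -- closure step per round. The initial family of an input consists of the sets containing its
    -- edge.
    family : ℕ → I → Family
    join   : ℕ → List I → Family
    family zero    x B = maybe′ (λ e → does (e ∈ₑ? B)) true (input x)
    family (suc s) x B = meet (map (join s) (rules x)) B
    join s c A = any (λ z → family s z A) c

    module _ (nodes : List I) (closed : ∀ {x c z} → x ∈ nodes → c ∈ rules x → z ∈ c → z ∈ nodes) where

      loss : ∀ s x → _
      loss s x = meet-loss (map (join s) (rules x)) (suc r) [] (+-identityʳ (suc r)) []

      losses : ℕ → List (List (Edge m))
      losses zero    = []
      losses (suc s) = concatMap (λ x → proj₁ (loss s x)) nodes ++ losses s

      length-losses : ∀ s → length (losses s) ≤ s * (length nodes * width ^ suc r)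
      length-losses zero    = z≤n
      length-losses (suc s) = ≤-trans (≤-reflexive (length-++ (concatMap (λ x → proj₁ (loss s x)) nodes)))
        (+-mono-≤ (length-concatMap-≤ (λ x → proj₁ (loss s x)) _ nodes (All.tabulate λ {x} _ → proj₁ (proj₂ (loss s x)))) (length-losses s))

      losses-lost : ∀ s → Lost (losses s)
      losses-lost zero    = []
      losses-lost (suc s) = All.++⁺ (concatMap-All⁺ (λ x → proj₁ (loss s x)) nodes λ {x} _ → proj₁ (proj₂ (proj₂ (loss s x)))) (losses-lost s)

      -- A small witness inside `f` is carried from round to round: unions keep it, and meets supply
      -- a new one as `f` avoids their losses. At the start it is the input edge or the empty set.
      accepted : 1 ≤ r → ∀ f → IsInj f → ∀ s → Avoids f (losses s) →
                 ∀ {x} → x ∈ nodes → value (indicator f) s x ≡ true → AcceptsMap f (family s x)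
      accepted 1≤r f inj zero av {x} x∈ v with input x
      ... | nothing = [] , z≤n , refl , []
      ... | just e  = e ∷ [] , 1≤r , dec-true (e ∈ₑ? (e ∷ [])) (here refl) , does-true (lookup f (proj₁ e) ≟ proj₂ e) v ∷ []
      accepted 1≤r f inj (suc s) av {x} x∈ v =
        proj₂ (proj₂ (proj₂ (loss s x))) f inj [] here-av (All.map⁺ (All.tabulate joined))
        where
        here-av : Avoids f (proj₁ (loss s x))
        here-av = concatMap-All⁻ (λ x → proj₁ (loss s x)) nodes (All.++⁻ˡ (concatMap (λ x → proj₁ (loss s x)) nodes) av) x∈
        joined : ∀ {c} → c ∈ rules x → AcceptsMap f (join s c)
        joined {c} c∈ with any-elim (value (indicator f) s) c (all-elim _ (rules x) v c∈)
        ... | z , z∈ , vz with accepted 1≤r f inj s (All.++⁻ʳ (concatMap (λ x → proj₁ (loss s x)) nodes) av) (closed x∈ c∈ z∈) vz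
        ...   | A , lenA , wA , fA = A , lenA , any-intro (λ z → family s z A) c z∈ wA , fA

      -- The closure step has added `B`, but `h` makes `B` monochromatic while the union itself
      -- rejects `h`. The guard by `closure` makes this event rare for every `B`.
      error : ℕ → List I → List (Edge m) → Colouring m → Bool
      error s c B h = closure (join s c) B ∧ uncovered (join s c) B h

      ruleErrors : ℕ → List I → List (Colouring m → Bool)
      ruleErrors s c = map (error s c) smallSets

      nodeErrors : ℕ → I → List (Colouring m → Bool)
      nodeErrors s x = concatMap (ruleErrors s) (rules x)

      errors : ℕ → List (Colouring m → Bool)
      errors zero    = []
      errors (suc s) = concatMap (nodeErrors s) nodes ++ errors s

      length-errors : ∀ ρ → All (λ x → length (rules x) ≤ ρ) nodes → ∀ s →
                      length (errors s) ≤ s * (length nodes * (ρ * length smallSets))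
      length-errors ρ few zero    = z≤n
      length-errors ρ few (suc s) = ≤-trans (≤-reflexive (length-++ (concatMap (nodeErrors s) nodes)))
        (+-mono-≤ (length-concatMap-≤ (nodeErrors s) _ nodes (All.map (λ {x} le → ≤-trans
            (length-concatMap-≤ (ruleErrors s) (length smallSets) (rules x) (All.tabulate λ {c} _ → ≤-reflexive (length-map (error s c) smallSets)))
            (*-monoˡ-≤ (length smallSets) le)) few))
          (length-errors ρ few s))

      rare : ∀ s c B → # (error s c B) colourings * 2 ^ q ≤ total
      rare s c B with closure (join s c) B in eq
      ... | true  = does-true (# (uncovered (join s c) B) colourings * 2 ^ q ≤? total) eq
      ... | false = ≤-trans (≤-reflexive (cong (_* 2 ^ q) (never (colourings {m})))) z≤n
        where
        never : ∀ {X : Set} (xs : List X) → # (λ _ → false) xs ≡ 0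
        never []       = refl
        never (x ∷ xs) = never xs

      errors-rare : ∀ s → All (λ E → # E colourings * 2 ^ q ≤ total) (errors s)
      errors-rare zero    = []
      errors-rare (suc s) = All.++⁺ (concatMap-All⁺ (nodeErrors s) nodes λ {x} _ →
        concatMap-All⁺ (ruleErrors s) (rules x) λ {c} _ → All.map⁺ (All.tabulate λ {B} _ → rare s c B)) (errors-rare s)

      -- When `h` avoids all errors, a monochromatic set added by a closure can be traded for a
      -- monochromatic member of the union itself, round by round down to the inputs.
      sound : ∀ h s → All (λ E → E h ≡ false) (errors s) → ∀ {x} → x ∈ nodes →
              accepts (family s x) h ≡ true → value (mono h) s x ≡ true
      sound h zero av {x} x∈ acc with input x
      ... | nothing = refl
      ... | just e with any-elim _ smallSets acc
      ...   | B , _ , eq = all-elim (mono h) B (∧-elimʳ (does (e ∈ₑ? B)) eq) (does-true (e ∈ₑ? B) (∧-elimˡ _ eq))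
      sound h (suc s) av {x} x∈ acc with any-elim _ smallSets acc
      ... | B , B∈ , eq = all-intro _ (rules x) satisfied
        where
        in-meet : meet (map (join s) (rules x)) B ≡ true
        in-meet = ∧-elimˡ (family (suc s) x B) eq
        monoB : monos h B ≡ true
        monoB = ∧-elimʳ (family (suc s) x B) eq
        no-error : ∀ {c} → c ∈ rules x → error s c B h ≡ false
        no-error {c} c∈ = All.lookup (All.map⁻ (concatMap-All⁻ (ruleErrors s) (rules x)
          (concatMap-All⁻ (nodeErrors s) nodes (All.++⁻ˡ (concatMap (nodeErrors s) nodes) av) x∈) c∈)) B∈
        covered : ∀ {c} → c ∈ rules x → accepts (join s c) h ≡ true
        covered {c} c∈ with accepts (join s c) h in a
        ... | true  = refl
        ... | false = ⊥-elim (true≢false (∧-introᵇ (all-elim _ _ in-meet (∈-map⁺ (join s) c∈))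
                                (∧-introᵇ monoB (cong not a))) (no-error c∈))
        satisfied : ∀ {c} → c ∈ rules x → any (value (mono h) s) c ≡ true
        satisfied {c} c∈ with any-elim _ smallSets (covered c∈)
        ... | A , A∈ , eqA with any-elim _ c (∧-elimˡ (join s c A) eqA)
        ...   | z , z∈ , fz = any-intro _ c z∈ (sound h s (All.++⁻ʳ (concatMap (nodeErrors s) nodes) av)
                  (closed x∈ c∈ z∈) (any-intro _ smallSets A∈ (∧-introᵇ fz (∧-elimʳ (join s c A) eqA))))

      -- Few losses leave a perfect matching `f` that puts a small `A` inside `f` into the output
      -- family. The family then accepts every colouring making `A` monochromatic; the odd ones
      -- among these outnumber the errors, so the network accepts an odd colouring.
      lower-bound : ∀ S ρ {out} → out ∈ nodes → 1 ≤ r → r < m →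
                    All (λ x → length (rules x) ≤ ρ) nodes →
                    (∀ f → IsInj f → value (indicator f) S out ≡ true) →
                    (∀ h → odd h ≡ true → value (mono h) S out ≡ false) →
                    S * (length nodes * width ^ suc r) < (m ∸ r) ^ suc r →
                    S * (length nodes * (ρ * suc (m * m) ^ r)) * 2 ^ suc r < 2 ^ q → ⊥
      lower-bound S ρ {out} out∈ 1≤r r<m few accept reject small-loss small-error
        with injection-avoiding r (losses S) (losses-lost S) (≤-<-trans (length-losses S) small-loss)
      ... | f , inj , av with accepted 1≤r f inj S av out∈ (accept f inj)
      ...   | A , lenA , wA , fA = contradictory (#-avoid (errors S) P colourings few-errors)
        where
        P : Colouring m → Bool
        P h = monos h A ∧ odd h
        open ≤-Reasoning
        total-bound : total ≤ 2 ^ suc r * # P colourings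
        total-bound = ≤-trans (many-odd A (graph-matching f inj fA) (≤-<-trans lenA r<m))
                        (*-monoˡ-≤ (# P colourings) (^-monoʳ-≤ 2 (s≤s lenA)))
        P-positive : 1 ≤ # P colourings
        P-positive = n≢0⇒n>0 λ eq → <⇒≱ (colourings-nonempty {m})
          (≤-trans total-bound (≤-reflexive (trans (cong (2 ^ suc r *_) eq) (*-zeroʳ (2 ^ suc r)))))
        length-edges : length edges ≡ m * m
        length-edges = trans (length-cartesianProduct (allFin m) (allFin m)) (cong₂ _*_ (length-tabulate {n = m} id) (length-tabulate {n = m} id))
        number : length (errors S) ≤ S * (length nodes * (ρ * suc (m * m) ^ r))
        number = ≤-trans (length-errors ρ few S) (*-monoʳ-≤ S (*-monoʳ-≤ (length nodes) (*-monoʳ-≤ ρ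
                   (≤-trans (length-lists edges r) (≤-reflexive (cong (λ k → suc k ^ r) length-edges))))))
        few-errors : sum (map (λ E → # E colourings) (errors S)) < # P colourings
        few-errors = *-cancelʳ-< (2 ^ q) _ _ (begin-strict
          sum (map (λ E → # E colourings) (errors S)) * 2 ^ q        ≡⟨ sum-*ʳ (λ E → # E colourings) (2 ^ q) (errors S) ⟩
          sum (map (λ E → # E colourings * 2 ^ q) (errors S))        ≤⟨ sum-bounded _ total (errors S) (errors-rare S) ⟩
          length (errors S) * total                                  ≤⟨ *-mono-≤ number total-bound ⟩
          S * (length nodes * (ρ * suc (m * m) ^ r)) * (2 ^ suc r * # P colourings)
            ≡⟨ sym (*-assoc (S * (length nodes * (ρ * suc (m * m) ^ r))) (2 ^ suc r) _) ⟩
          S * (length nodes * (ρ * suc (m * m) ^ r)) * 2 ^ suc r * # P colourings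
            <⟨ *-monoˡ-< (# P colourings) {{>-nonZero P-positive}} small-error ⟩
          2 ^ q * # P colourings                                     ≡⟨ *-comm (2 ^ q) _ ⟩
          # P colourings * 2 ^ q                                     ∎)
        contradictory : Σ (Colouring m) (λ h → P h ≡ true × All (λ E → E h ≡ false) (errors S)) → ⊥
        contradictory (h , Ph , avh) = true≢false
          (sound h S avh out∈ (any-intro _ smallSets (∈-smallSets A lenA) (∧-introᵇ wA (∧-elimˡ (monos h A) Ph))))
          (reject h (∧-elimʳ (monos h A) Ph))

-- Unit propagation as a monotone network

drop-or-keep : ∀ {X : Set} {P Q : X → Bool} → Q ⇛ P → ∀ xs →
               (∀ {x} → x ∈ xs → P x ≡ true → Q x ≡ true) ⊎ suc (# Q xs) ≤ # P xs
drop-or-keep QP [] = inj₁ λ ()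
drop-or-keep {P = P} {Q} QP (x ∷ xs) with drop-or-keep {P = P} {Q} QP xs
... | inj₂ drop = inj₂ (≤-trans (≤-reflexive (sym (+-suc (𝟙 (Q x)) _))) (+-mono-≤ (𝟙-mono (Q x) (P x) (QP x)) drop))
... | inj₁ keep with P x in px | Q x in qx
...   | true  | true  = inj₁ λ { (here refl) _ → qx ; (there x∈) → keep x∈ }
...   | false | _     = inj₁ λ { (here refl) px′ → ⊥-elim (true≢false px′ px) ; (there x∈) → keep x∈ }
...   | true  | false = inj₂ (s≤s (#-mono QP xs))

-- A decreasing chain of subsets of `xs` shrinks at most `length xs` times: `by-stage n` finds a
-- repetition by stage `n` or at least n + 1 elements lost.
stabilises : ∀ {X : Set} (P : ℕ → X → Bool) → (∀ s → P (suc s) ⇛ P s) → ∀ xs →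
             Σ ℕ λ s → s ≤ length xs × (∀ {x} → x ∈ xs → P s x ≡ true → P (suc s) x ≡ true)
stabilises P decreasing xs with by-stage (length xs)
  where
  by-stage : ∀ n → (Σ ℕ λ s → s ≤ n × (∀ {x} → x ∈ xs → P s x ≡ true → P (suc s) x ≡ true))
                   ⊎ # (P (suc n)) xs + suc n ≤ length xs
  by-stage zero with drop-or-keep (decreasing 0) xs
  ... | inj₁ keep = inj₁ (0 , z≤n , keep)
  ... | inj₂ drop = inj₂ (≤-trans (≤-reflexive (+-comm _ 1)) (≤-trans drop (#-≤-length (P 0) xs)))
  by-stage (suc n) with by-stage n
  ... | inj₁ (s , s≤n , keep) = inj₁ (s , m≤n⇒m≤1+n s≤n , keep)
  ... | inj₂ few with drop-or-keep (decreasing (suc n)) xs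
  ...   | inj₁ keep = inj₁ (suc n , ≤-refl , keep)
  ...   | inj₂ drop = inj₂ (≤-trans (≤-reflexive (+-suc _ (suc n))) (≤-trans (+-monoˡ-≤ (suc n) drop) few))
... | inj₁ found = found
... | inj₂ few   = ⊥-elim (<⇒≱ (m≤n+m (suc (length xs)) (# (P (suc (length xs))) xs)) few)

-- Literals, resolvents and restrictions

compl-involutive : ∀ l → compl (compl l) ≡ l
compl-involutive (mkLit v s) = cong (mkLit v) (not-involutive s)

p-injective : ∀ {a b c d} → p a b ≡ p c d → a ≡ c × b ≡ d
p-injective refl = refl , refl

_≟ᵛ_ : (v w : Var) → Dec (v ≡ w)
p a b ≟ᵛ p c d = map′ (λ { (refl , refl) → refl }) p-injective ((a ℕ.≟ c) ×-dec (b ℕ.≟ d))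
p _ _ ≟ᵛ aux _ = no λ ()
aux _ ≟ᵛ p _ _ = no λ ()
aux a ≟ᵛ aux b = map′ (cong aux) (λ { refl → refl }) (a ℕ.≟ b)

_≟ˡ_ : (l k : Lit) → Dec (l ≡ k)
mkLit v s ≟ˡ mkLit w t = map′ (λ { (refl , refl) → refl }) (λ { refl → refl , refl }) ((v ≟ᵛ w) ×-dec (s Bool.≟ t))

NonTautological : Clause → Set
NonTautological C = ∀ l → l ∈ C → ¬ (compl l ∈ C)

resolvent-sym : ∀ {C D R} → Resolvent C D R → Resolvent D C R
resolvent-sym {C} {D} (x , x∈ , x̄∈ , unique , lits) =
  compl x , x̄∈ , subst (_∈ C) (sym (compl-involutive x)) x∈ ,
  (λ y y∈ ȳ∈ → trans (sym (compl-involutive y)) (cong compl (unique (compl y) ȳ∈ (subst (_∈ D) (sym (compl-involutive y)) y∈)))) ,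
  λ l → (λ l∈ → let (s , a , b) = proj₁ (lits l) l∈ in Sum.swap s , b , λ eq → a (trans eq (compl-involutive x))) ,
        (λ { (s , b , a) → proj₂ (lits l) (Sum.swap s , (λ eq → a (trans eq (sym (compl-involutive x)))) , b) })

-- A complementary pair of `R` split between `C` and `D` would be a clash other than the one at `x`.
resolvent-nonTautological : ∀ {C D R} → NonTautological C → NonTautological D → Resolvent C D R → NonTautological R
resolvent-nonTautological {C} {D} ntC ntD (x , _ , _ , unique , lits) l l∈ l̄∈
  with proj₁ (lits l) l∈ | proj₁ (lits (compl l)) l̄∈
... | inj₁ l∈C , _ , _   | inj₁ l̄∈C , _ , _ = ntC l l∈C l̄∈C
... | inj₂ l∈D , _ , _   | inj₂ l̄∈D , _ , _ = ntD l l∈D l̄∈D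
... | inj₁ l∈C , l≢x , _ | inj₂ l̄∈D , _ , _ = l≢x (unique l l∈C l̄∈D)
... | inj₂ l∈D , _ , _   | inj₁ l̄∈C , l̄≢x , _ =
  l̄≢x (unique (compl l) l̄∈C (subst (_∈ D) (sym (compl-involutive l)) l∈D))

∈-removeFalse⁺ : ∀ φ {l} C → l ∈ C → litFalse φ l ≡ false → l ∈ removeFalse φ C
∈-removeFalse⁺ φ (k ∷ C) (here refl) eq rewrite eq = here refl
∈-removeFalse⁺ φ (k ∷ C) (there l∈)  eq with litFalse φ k
... | true  = ∈-removeFalse⁺ φ C l∈ eq
... | false = there (∈-removeFalse⁺ φ C l∈ eq)

∈-removeFalse⁻ : ∀ φ {l} C → l ∈ removeFalse φ C → l ∈ C × litFalse φ l ≡ false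
∈-removeFalse⁻ φ (k ∷ C) l∈ with litFalse φ k in eq
... | true  = let (l∈C , f) = ∈-removeFalse⁻ φ C l∈ in there l∈C , f
∈-removeFalse⁻ φ (k ∷ C) (here refl) | false = here refl , eq
∈-removeFalse⁻ φ (k ∷ C) (there l∈)  | false = let (l∈C , f) = ∈-removeFalse⁻ φ C l∈ in there l∈C , f

∈-⋆⁻ : ∀ φ {K} F → K ∈ φ ⋆ F → Σ Clause λ C → C ∈ F × K ≡ removeFalse φ C
∈-⋆⁻ φ (C ∷ F) K∈ with clauseSatP φ C
∈-⋆⁻ φ (C ∷ F) K∈          | true  = let (D , D∈ , eq) = ∈-⋆⁻ φ F K∈ in D , there D∈ , eq
∈-⋆⁻ φ (C ∷ F) (here refl) | false = C , here refl , refl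
∈-⋆⁻ φ (C ∷ F) (there K∈)  | false = let (D , D∈ , eq) = ∈-⋆⁻ φ F K∈ in D , there D∈ , eq

∈-⋆⁺ : ∀ φ {C} F → C ∈ F → clauseSatP φ C ≡ true ⊎ removeFalse φ C ∈ φ ⋆ F
∈-⋆⁺ φ (C ∷ F) (here refl) with clauseSatP φ C
... | true  = inj₁ refl
... | false = inj₂ (here refl)
∈-⋆⁺ φ (D ∷ F) (there C∈) with clauseSatP φ D | ∈-⋆⁺ φ F C∈
... | _     | inj₁ sat = inj₁ sat
... | true  | inj₂ K∈  = inj₂ K∈
... | false | inj₂ K∈  = inj₂ (there K∈)

clauseSatP⁻ : ∀ φ C → clauseSatP φ C ≡ true → Σ Lit λ l → l ∈ C × litTrue φ l ≡ true
clauseSatP⁻ φ (l ∷ C) eq with litTrue φ l in lt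
... | true  = l , here refl , lt
... | false = let (k , k∈ , kt) = clauseSatP⁻ φ C eq in k , there k∈ , kt

litTrue⁻ : ∀ φ l → litTrue φ l ≡ true → φ (var l) ≡ just (sign l)
litTrue⁻ φ (mkLit v s) eq with φ v
litTrue⁻ φ (mkLit v true)  eq | just true  = refl
litTrue⁻ φ (mkLit v false) eq | just false = refl

litFalse⁻ : ∀ φ l → litFalse φ l ≡ true → φ (var l) ≡ just (not (sign l))
litFalse⁻ φ (mkLit v s) eq with φ v
litFalse⁻ φ (mkLit v false) eq | just true  = refl
litFalse⁻ φ (mkLit v true)  eq | just false = refl

¬litFalse : ∀ φ l {b} → litFalse φ l ≡ false → φ (var l) ≡ just b → b ≡ sign l
¬litFalse φ (mkLit v s) eq φv with φ v
¬litFalse φ (mkLit v true)  eq refl | just true  = refl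
¬litFalse φ (mkLit v false) eq refl | just false = refl

extend : PAss → PAss → Var → Bool
extend φ ψ v = maybe′ id (maybe′ id false (ψ v)) (φ v)

extend-sat : ∀ φ ψ F → ψ ⋆ (φ ⋆ F) ≡ [] → Sat (extend φ ψ) F
extend-sat φ ψ F empty = All.tabulate sat
  where
  sat : ∀ {C} → C ∈ F → Any (λ l → extend φ ψ (var l) ≡ sign l) C
  sat {C} C∈ with ∈-⋆⁺ φ F C∈
  ... | inj₁ satφ with clauseSatP⁻ φ C satφ
  ...   | l , l∈ , lt = lose l∈ (cong (maybe′ id (maybe′ id false (ψ (var l)))) (litTrue⁻ φ l lt))
  sat {C} C∈ | inj₂ K∈ with ∈-⋆⁺ ψ (φ ⋆ F) K∈
  ...   | inj₂ K′∈ with () ← subst (removeFalse ψ (removeFalse φ C) ∈_) empty K′∈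
  ...   | inj₁ satψ with clauseSatP⁻ ψ (removeFalse φ C) satψ
  ...     | l , l∈ , lt with ∈-removeFalse⁻ φ C l∈
  ...       | l∈C , ¬f = lose l∈C (agree (φ (var l)) refl)
    where
    agree : ∀ b → φ (var l) ≡ b → maybe′ id (maybe′ id false (ψ (var l))) b ≡ sign l
    agree (just b) eq = ¬litFalse φ l ¬f eq
    agree nothing  eq = cong (maybe′ id false) (litTrue⁻ ψ l lt)

≡ᵇ-refl : ∀ n → (n ≡ᵇ n) ≡ true
≡ᵇ-refl zero    = refl
≡ᵇ-refl (suc n) = ≡ᵇ-refl n

-- Edges as variables, injections as satisfying assignments

module _ {m : ℕ} where

  -- Pigeons and holes are numbered from 1, so 0 and numbers above `m` denote none.
  decode : ℕ → Maybe (Fin m)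
  decode zero = nothing
  decode (suc a) with a <? m
  ... | yes a<m = just (fromℕ< a<m)
  ... | no  _   = nothing

  decode-toℕ : ∀ i → decode (suc (toℕ i)) ≡ just i
  decode-toℕ i with toℕ i <? m
  ... | yes lt = cong just (fromℕ<-toℕ i lt)
  ... | no ¬lt = ⊥-elim (¬lt (toℕ<n i))

  decode-just : ∀ a {i} → decode a ≡ just i → a ≡ suc (toℕ i)
  decode-just (suc a) eq with a <? m
  decode-just (suc a) refl | yes lt = cong suc (sym (toℕ-fromℕ< lt))

  varOf : Edge m → Var
  varOf (i , j) = p (suc (toℕ i)) (suc (toℕ j))

  edgeOf : Var → Maybe (Edge m)
  edgeOf (aux _) = nothing
  edgeOf (p a b) = maybe′ (λ i → maybe′ (λ j → just (i , j)) nothing (decode b)) nothing (decode a)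

  edgeOf-varOf : ∀ e → edgeOf (varOf e) ≡ just e
  edgeOf-varOf (i , j) rewrite decode-toℕ i | decode-toℕ j = refl

  edgeOf-just : ∀ v {e} → edgeOf v ≡ just e → v ≡ varOf e
  edgeOf-just (p a b) eq with decode a in eqa
  ... | just i with decode b in eqb
  edgeOf-just (p a b) refl | just i | just j = cong₂ p (decode-just a eqa) (decode-just b eqb)

  ∈-idx : ∀ (i : Fin m) → suc (toℕ i) ∈ idx m
  ∈-idx i = ∈-map⁺ suc (∈-upTo⁺ (toℕ<n i))

  ∈-idx⁻ : ∀ {a} → a ∈ idx m → Σ (Fin m) λ i → a ≡ suc (toℕ i)
  ∈-idx⁻ a∈ with ∈-map⁻ suc a∈
  ... | a′ , a′∈ , refl = fromℕ< (∈-upTo⁻ a′∈) , cong suc (sym (toℕ-fromℕ< (∈-upTo⁻ a′∈)))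

  inRange : ∀ (i : Fin m) → InRange m (suc (toℕ i))
  inRange i = s≤s z≤n , toℕ<n i

  ≡ᵇ-toℕ : ∀ {i j : Fin m} → i ≢ j → (suc (toℕ i) ≡ᵇ suc (toℕ j)) ≡ false
  ≡ᵇ-toℕ {i} {j} i≢j with toℕ i ≡ᵇ toℕ j in eq
  ... | false = refl
  ... | true  = ⊥-elim (i≢j (toℕ-injective (≡ᵇ⇒≡ (toℕ i) (toℕ j) (subst T (sym eq) tt))))

  assignment : Vec (Fin m) m → Var → Bool
  assignment f v = maybe′ (indicator f) false (edgeOf v)

  assignment-varOf : ∀ f e → assignment f (varOf e) ≡ indicator f e
  assignment-varOf f e = cong (maybe′ (indicator f) false) (edgeOf-varOf e)

  holeClause : ℕ → ℕ → ℕ → ClauseSet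
  holeClause j i₁ i₂ = if i₁ ≡ᵇ i₂ then [] else (neg (p i₁ j) ∷ neg (p i₂ j) ∷ []) ∷ []

  assignment-sat : ∀ f → IsInj f → Sat (assignment f) (PHP m)
  assignment-sat f inj = All.++⁺ (All.map⁺ (All.tabulate pigeon))
    (concatMap-All⁺ (λ j → concatMap (λ i₁ → concatMap (holeClause j i₁) (idx m)) (idx m)) (idx m) λ {j} j∈ →
     concatMap-All⁺ (λ i₁ → concatMap (holeClause j i₁) (idx m)) (idx m) λ {i₁} i₁∈ →
     concatMap-All⁺ (holeClause j i₁) (idx m) λ {i₂} i₂∈ → hole j∈ i₁∈ i₂∈)
    where
    pigeon : ∀ {i} → i ∈ idx m → Any (λ l → assignment f (var l) ≡ sign l) (map (λ j → pos (p i j)) (idx m))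
    pigeon i∈ with ∈-idx⁻ i∈
    ... | i , refl = lose (∈-map⁺ (λ j → pos (p (suc (toℕ i)) j)) (∈-idx (lookup f i)))
                          (trans (assignment-varOf f (i , lookup f i)) (dec-true (lookup f i ≟ lookup f i) refl))
    hole : ∀ {j i₁ i₂} → j ∈ idx m → i₁ ∈ idx m → i₂ ∈ idx m →
           All (Any (λ l → assignment f (var l) ≡ sign l)) (holeClause j i₁ i₂)
    hole j∈ i₁∈ i₂∈ with ∈-idx⁻ j∈ | ∈-idx⁻ i₁∈ | ∈-idx⁻ i₂∈
    ... | j , refl | i₁ , refl | i₂ , refl with i₁ ≟ i₂
    ...   | yes refl rewrite ≡ᵇ-refl (toℕ i₁) = []
    ...   | no  i₁≢i₂ rewrite ≡ᵇ-toℕ i₁≢i₂ with lookup f i₁ ≟ j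
    ...     | no  f₁≢ = here (trans (assignment-varOf f (i₁ , j)) (dec-false (lookup f i₁ ≟ j) f₁≢)) ∷ []
    ...     | yes f₁≡ = there (here (trans (assignment-varOf f (i₂ , j))
                          (dec-false (lookup f i₂ ≟ j) (λ f₂≡ → i₁≢i₂ (inj i₁ i₂ (trans f₁≡ (sym f₂≡))))))) ∷ []

  -- Each pigeon clause selects a hole, and the hole clauses make the selection injective.
  sat-injection : ∀ β → Sat β (PHP m) → Σ (Vec (Fin m) m) λ f → IsInj f × (∀ i → β (varOf (i , lookup f i)) ≡ true)
  sat-injection β sat = Vec.tabulate image , injective , λ i → subst (λ j → β (varOf (i , j)) ≡ true) (sym (lookup∘tabulate image i)) (proj₂ (choose i))
    where
    choose : ∀ i → Σ (Fin m) λ j → β (varOf (i , j)) ≡ true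
    choose i with find (All.lookup sat (∈-++⁺ˡ (∈-map⁺ (λ i → map (λ j → pos (p i j)) (idx m)) (∈-idx i))))
    ... | l , l∈ , eq with ∈-map⁻ (λ j → pos (p (suc (toℕ i)) j)) l∈
    ...   | j , j∈ , refl with ∈-idx⁻ j∈
    ...     | j′ , refl = j′ , eq
    image : Fin m → Fin m
    image = proj₁ ∘ choose
    exclusive : ∀ {i₁ i₂ j} → i₁ ≢ i₂ → β (varOf (i₁ , j)) ≡ true → β (varOf (i₂ , j)) ≡ true → ⊥
    exclusive {i₁} {i₂} {j} i₁≢i₂ b₁ b₂ with subst (All _) holes-eq holes
      where
      holes : All (Any (λ l → β (var l) ≡ sign l)) (holeClause (suc (toℕ j)) (suc (toℕ i₁)) (suc (toℕ i₂)))
      holes = concatMap-All⁻ (holeClause (suc (toℕ j)) (suc (toℕ i₁))) (idx m)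
        (concatMap-All⁻ (λ i₁ → concatMap (holeClause (suc (toℕ j)) i₁) (idx m)) (idx m)
          (concatMap-All⁻ (λ j → concatMap (λ i₁ → concatMap (holeClause j i₁) (idx m)) (idx m)) (idx m)
            (All.++⁻ʳ (map (λ i → map (λ j → pos (p i j)) (idx m)) (idx m)) sat) (∈-idx j)) (∈-idx i₁)) (∈-idx i₂)
      holes-eq : holeClause (suc (toℕ j)) (suc (toℕ i₁)) (suc (toℕ i₂)) ≡ (neg (varOf (i₁ , j)) ∷ neg (varOf (i₂ , j)) ∷ []) ∷ []
      holes-eq rewrite ≡ᵇ-toℕ i₁≢i₂ = refl
    ... | here f₁ ∷ []         = true≢false b₁ f₁
    ... | there (here f₂) ∷ [] = true≢false b₂ f₂
    injective : IsInj (Vec.tabulate image)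
    injective i₁ i₂ eq with i₁ ≟ i₂
    ... | yes same  = same
    ... | no  i₁≢i₂ = ⊥-elim (exclusive i₁≢i₂ (subst (λ j → β (varOf (i₁ , j)) ≡ true) images (proj₂ (choose i₁))) (proj₂ (choose i₂)))
      where
      images : image i₁ ≡ image i₂
      images = trans (sym (lookup∘tabulate image i₁)) (trans eq (lookup∘tabulate image i₂))

-- Trees of Horton-Strahler number at most 1

hts-leafʳ : ∀ C D T → hts (node C (leaf D) T) ≤ 1 → hts T ≤ 1
hts-leafʳ C D T le with hts T
... | zero  = z≤n
... | suc _ = le

hts-leafˡ : ∀ C D T → hts (node C T (leaf D)) ≤ 1 → hts T ≤ 1
hts-leafˡ C D T le with hts T
... | zero  = z≤n
... | suc _ = le

hts-node : ∀ C T₁ T₂ → 1 ≤ hts (node C T₁ T₂)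
hts-node C T₁ T₂ with hts T₁ | hts T₂
... | zero  | zero  = ≤-refl
... | zero  | suc _ = s≤s z≤n
... | suc a | zero  = s≤s z≤n
... | suc a | suc b with a ≡ᵇ b
...   | true  = s≤s z≤n
...   | false = s≤s z≤n

-- Consequently every inner node of a tree with number at most 1 has a leaf as a child, which is
-- input resolution.
hts-two-nodes : ∀ C T₁ T₂ → 1 ≤ hts T₁ → 1 ≤ hts T₂ → ¬ hts (node C T₁ T₂) ≤ 1
hts-two-nodes C T₁ T₂ le₁ le₂ le with hts T₁ | hts T₂
... | suc zero    | suc zero    = <⇒≱ (s≤s (s≤s z≤n)) le
... | suc zero    | suc (suc b) = <⇒≱ (s≤s (s≤s z≤n)) le
... | suc (suc a) | suc zero    = <⇒≱ (s≤s (s≤s z≤n)) le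
... | suc (suc a) | suc (suc b) with a ≡ᵇ b
...   | true  = <⇒≱ (s≤s (s≤s z≤n)) le
...   | false = <⇒≱ (s≤s (s≤s z≤n)) le

length-concat : ∀ F → length (concat F) ≡ ℓ F
length-concat []      = refl
length-concat (C ∷ F) = trans (length-++ C) (cong (length C +_) (length-concat F))

-- A satisfiable clause-set has no empty clause, so every clause contributes a literal.
length-≤-ℓ : ∀ {β} F → Sat β F → length F ≤ ℓ F
length-≤-ℓ []            []           = z≤n
length-≤-ℓ ((_ ∷ _) ∷ F) (_ ∷ sat)    = s≤s (≤-trans (length-≤-ℓ F sat) (m≤n+m _ _))

-- Unit propagation on φ ⋆ F, where φ falsifies the variables of the missing edges. The node `just l`
-- has value true in round s if l has not been derived by then, the node `nothing` if no conflict has.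
module Propagation (m r q : ℕ) (F : ClauseSet) where

  -- Falsifying a missing edge derives its negative literal at once, while a present edge leaves it
  -- underived; all other literals start underived.
  input : Maybe Lit → Maybe (Edge m)
  input nothing                = nothing
  input (just (mkLit v true))  = nothing
  input (just (mkLit v false)) = edgeOf v

  _≟ⁿ_ : (x y : Maybe Lit) → Dec (x ≡ y)
  _≟ⁿ_ = Maybe.≡-dec _≟ˡ_

  other? : ∀ x y → Dec (just y ≢ x)
  other? x y = ¬? (just y ≟ⁿ x)

  -- `C` does not derive `x` as long as another literal of `C` is unrefuted, that is, has an
  -- underived complement. For `nothing` the rule describes a conflict.
  clauseRule : Maybe Lit → Clause → List (Maybe Lit)
  clauseRule x C = map (just ∘ compl) (filter (other? x) C)

  -- The rule `x ∷ []` keeps derived literals derived, so values only decrease.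
  rules : Maybe Lit → List (List (Maybe Lit))
  rules x = (x ∷ []) ∷ map (clauseRule x) F

  open Approximation m r q using (core)
  open LowerBound m r q using (width; module Network)
  open Network input rules using (value; lower-bound)

  literals : List Lit
  literals = concat F ++ map compl (concat F)

  nodes : List (Maybe Lit)
  nodes = nothing ∷ map just literals

  ∈-nodes : ∀ {l C} → C ∈ F → l ∈ C → just l ∈ nodes
  ∈-nodes C∈ l∈ = there (∈-map⁺ just (∈-++⁺ˡ (∈-concat⁺′ l∈ C∈)))

  nodes-closed : ∀ {x c z} → x ∈ nodes → c ∈ rules x → z ∈ c → z ∈ nodes
  nodes-closed x∈ (here refl) (here refl) = x∈
  nodes-closed {x} x∈ (there c∈) z∈ with ∈-map⁻ (clauseRule x) c∈
  ... | C , C∈ , refl with ∈-map⁻ (just ∘ compl) z∈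
  ...   | y , y∈ , refl = there (∈-map⁺ just (∈-++⁺ʳ (concat F)
            (∈-map⁺ compl (∈-concat⁺′ (proj₁ (∈-filter⁻ (other? x) {xs = C} y∈)) C∈))))

  length-nodes : length nodes ≡ suc (ℓ F + ℓ F)
  length-nodes = cong suc (trans (length-map just literals) (trans (length-++ (concat F))
    (cong₂ _+_ (length-concat F) (trans (length-map compl (concat F)) (length-concat F)))))

  value-decreasing : ∀ G s → value G (suc s) ⇛ value G s
  value-decreasing G s x eq with any-elim (value G s) (x ∷ []) (∧-elimˡ _ eq)
  ... | _ , here refl , v = v

  value-antitone : ∀ G {s t} → s ≤ t → value G t ⇛ value G s
  value-antitone G {t = zero}  z≤n x eq = eq
  value-antitone G {s} {suc t} s≤t x eq with m≤n⇒m<n∨m≡n s≤t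
  ... | inj₁ (s≤s s≤t′) = value-antitone G s≤t′ x (value-decreasing G t x eq)
  ... | inj₂ refl       = eq

  Falsified : (Var → Bool) → Maybe Lit → Set
  Falsified β nothing  = ⊤
  Falsified β (just l) = β (var l) ≢ sign l

  matching-extension : Represents m F → ∀ f → IsInj f →
                       Σ (Var → Bool) λ β → Sat β F × (∀ e → β (varOf e) ≡ indicator f e)
  matching-extension (_ , rep) f inj with proj₁ (rep (assignment f)) (assignment-sat f inj)
  ... | β , sat , agree = β , sat , λ { e@(i , j) → trans (agree _ _ (inRange i) (inRange j)) (assignment-varOf f e) }

  -- Soundness of unit propagation. Every clause has a literal `y` true under `β`; it differs from
  -- `x`, and its complement is false, hence underived by induction.
  falsified-survives : ∀ f {β} → Sat β F → (∀ e → β (varOf e) ≡ indicator f e) →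
                       ∀ s x → Falsified β x → value (indicator f) s x ≡ true
  falsified-survives f sat agree zero nothing _ = refl
  falsified-survives f sat agree zero (just (mkLit v true)) _ = refl
  falsified-survives f {β} sat agree zero (just (mkLit v false)) fx with edgeOf {m} v in eq
  ... | nothing = refl
  ... | just e  = trans (sym (agree e)) (trans (cong β (sym (edgeOf-just v eq))) (¬-not fx))
  falsified-survives f {β} sat agree (suc s) x fx = all-intro _ (rules x) surviving
    where
    distinct : ∀ {y} → β (var y) ≡ sign y → Falsified β x → just y ≢ x
    distinct eq fx refl = fx eq
    surviving : ∀ {c} → c ∈ rules x → any (value (indicator f) s) c ≡ true
    surviving (here refl) = any-intro (value (indicator f) s) (x ∷ []) (here refl) (falsified-survives f sat agree s x fx)
    surviving (there c∈) with ∈-map⁻ (clauseRule x) c∈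
    ... | C , C∈ , refl with find (All.lookup sat C∈)
    ...   | y , y∈ , eq = any-intro _ (clauseRule x C)
              (∈-map⁺ (just ∘ compl) (∈-filter⁺ (other? x) y∈ (distinct eq fx)))
              (falsified-survives f sat agree s (just (compl y)) (λ eq′ → not-¬ refl (trans (sym eq) eq′)))

  restriction : Colouring m → PAss
  restriction h v = maybe′ (λ e → if mono h e then nothing else just false) nothing (edgeOf v)

  restriction-outside : ∀ h v → ¬ Vm m v → restriction h v ≡ nothing
  restriction-outside h v ¬vm with edgeOf {m} v in eq
  ... | nothing      = refl
  ... | just (i , j) = ⊥-elim (¬vm (suc (toℕ i) , suc (toℕ j) , inRange i , inRange j , edgeOf-just v eq))

  restriction-just : ∀ h v {b} → restriction h v ≡ just b → b ≡ false × Σ (Edge m) λ e → v ≡ varOf e × mono h e ≡ false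
  restriction-just h v eq with edgeOf {m} v in eqv
  ... | just e with mono h e in eqe
  restriction-just h v refl | just e | false = refl , e , edgeOf-just v eqv , eqe

  restriction-missing : ∀ h e → mono h e ≡ false → restriction h (varOf e) ≡ just false
  restriction-missing h e eq rewrite edgeOf-varOf e | eq = refl

  -- A satisfying assignment would project to a perfect matching of monochromatic edges, all other
  -- edges being set to false, and parity forbids this.
  odd-unsat : Represents m F → ∀ h → odd h ≡ true → Unsat (restriction h ⋆ F)
  odd-unsat (_ , rep) h odd-h ψ empty with sat-injection β (proj₂ (rep β) (β , extend-sat (restriction h) ψ F empty , λ _ _ _ _ → refl))
    where
    β = extend (restriction h) ψ
  ... | f , inj , edges = true≢false odd-h (odd-unmatchable h f inj λ i → present (i , lookup f i) (edges i))
    where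
    present : ∀ e → extend (restriction h) ψ (varOf e) ≡ true → mono h e ≡ true
    present e eq with mono h e in eqe
    ... | true  = refl
    ... | false = ⊥-elim (true≢false eq (cong (maybe′ id (maybe′ id false (ψ (varOf e)))) (restriction-missing h e eqe)))

  module _ (clauses : All IsClause F) (h : Colouring m) (s : ℕ)
           (stable : ∀ {x} → x ∈ nodes → value (mono h) s x ≡ true → value (mono h) (suc s) x ≡ true)
           (no-conflict : value (mono h) s nothing ≡ true) where

    Underived : Lit → Set
    Underived l = value (mono h) s (just l) ≡ true

    Supported : Maybe Lit → Clause → Set
    Supported x C = Σ Lit λ y → y ∈ C × just y ≢ x × Underived (compl y)

    supported : ∀ {x C} → x ∈ nodes → value (mono h) s x ≡ true → C ∈ F → Supported x C
    supported {x} {C} x∈ vx C∈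
      with any-elim (value (mono h) s) (clauseRule x C) (all-elim _ (rules x) (stable x∈ vx) (there (∈-map⁺ (clauseRule x) C∈)))
    ... | z , z∈ , vz with ∈-map⁻ (just ∘ compl) z∈
    ...   | y , y∈ , refl = y , proj₁ (∈-filter⁻ (other? x) {xs = C} y∈) , proj₂ (∈-filter⁻ (other? x) {xs = C} y∈) , vz

    underived-edge : ∀ e → Underived (neg (varOf e)) → mono h e ≡ true
    underived-edge e u = trans (cong (maybe′ (mono h) true) (sym (edgeOf-varOf e)))
                           (value-antitone (mono h) {0} {s} z≤n (just (neg (varOf e))) u)

    -- The restriction removes only positive literals of missing edges, whose complements count as
    -- derived from round 0 on. So supporting literals survive it.
    underived-kept : ∀ y → Underived (compl y) → litFalse (restriction h) y ≡ false
    underived-kept y@(mkLit v b) u with litFalse (restriction h) y in eq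
    ... | false = refl
    ... | true with b | restriction-just h v (litFalse⁻ (restriction h) y eq)
    ...   | true  | _ , e , refl , missing = ⊥-elim (true≢false (underived-edge e u) missing)
    ...   | false | () , _

    -- At a stable stage no clause propagates anything new, so an axiom has support against every
    -- underived `x`. A resolvent keeps only the support for `nothing`, as `Derived` records.
    Input : Clause → Set
    Input L = NonTautological L × (∀ {l} → l ∈ L → just l ∈ nodes) ×
              (∀ {x} → x ∈ nodes → value (mono h) s x ≡ true → Supported x L)

    Derived : Clause → Set
    Derived R = NonTautological R × Supported nothing R

    input-clause : ∀ {L} → Any (L ≋_) (restriction h ⋆ F) → Input L
    input-clause {L} leafIn with find leafIn
    ... | K , K∈ , L≋K with ∈-⋆⁻ (restriction h) F K∈
    ...   | C , C∈ , refl = nontaut , (λ l∈ → ∈-nodes C∈ (toC l∈)) , support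
      where
      toC : ∀ {l} → l ∈ L → l ∈ C
      toC {l} l∈ = proj₁ (∈-removeFalse⁻ (restriction h) C (proj₁ (L≋K l) l∈))
      nontaut : NonTautological L
      nontaut l l∈ l̄∈ = proj₂ (All.lookup clauses C∈) l (toC l∈) (toC l̄∈)
      support : ∀ {x} → x ∈ nodes → value (mono h) s x ≡ true → Supported x L
      support x∈ vx with supported x∈ vx C∈
      ... | y , y∈ , ne , u = y , proj₂ (L≋K y) (∈-removeFalse⁺ (restriction h) C y∈ (underived-kept y u)) , ne , u

    input-derived : ∀ {L} → Input L → Derived L
    input-derived (nt , _ , support) = nt , support (here refl) no-conflict

    -- The unrefuted literal `y` of `D` survives unless it is the one resolved upon. In that case
    -- `x` is underived, and by stability the input clause `L` supplies another unrefuted literal.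
    input-resolution : ∀ {L D R} → Input L → Derived D → Resolvent L D R → Derived R
    input-resolution {L} {D} {R} (ntL , nodesL , support) (ntD , y , y∈ , _ , uy) res@(x , x∈ , x̄∈ , unique , lits) =
      resolvent-nonTautological ntL ntD res , from-D (y ≟ˡ compl x)
      where
      from-D : Dec (y ≡ compl x) → Supported nothing R
      from-D (no y≢x̄) = y , proj₂ (lits y) (inj₂ y∈ , (λ { refl → ntD y y∈ x̄∈ }) , y≢x̄) , (λ ()) , uy
      from-D (yes refl) with support (nodesL x∈) (subst Underived (compl-involutive x) uy)
      ... | z , z∈ , z≢x , uz = z , proj₂ (lits z) (inj₁ z∈ , (λ eq → z≢x (cong just eq)) , (λ { refl → ntL x x∈ z∈ })) , (λ ()) , uz

    derived : ∀ T → ValidTree T → LeavesIn (restriction h ⋆ F) T → hts T ≤ 1 → Derived (label T)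
    derived (leaf L) _ leafIn _ = input-derived (input-clause leafIn)
    derived (node R (leaf L) T) (res , _ , valid) (leafIn , leaves) le =
      input-resolution (input-clause leafIn) (derived T valid leaves (hts-leafʳ R L T le)) res
    derived (node R T@(node _ _ _) (leaf L)) (res , valid , _) (leaves , leafIn) le =
      input-resolution (input-clause leafIn) (derived T valid leaves (hts-leafˡ R L T le)) (resolvent-sym res)
    derived (node R T₁@(node C₁ T₁₁ T₁₂) T₂@(node C₂ T₂₁ T₂₂)) _ _ le =
      ⊥-elim (hts-two-nodes R T₁ T₂ (hts-node C₁ T₁₁ T₁₂) (hts-node C₂ T₂₁ T₂₂) le)

    irrefutable : ¬ HdLe (restriction h ⋆ F) 1
    irrefutable (T , (valid , leaves , root) , le) with subst Derived root (derived T valid leaves le)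
    ... | _ , _ , () , _

  rounds : ℕ
  rounds = suc (length nodes)

  odd-rejected : All IsClause F → Represents m F → HdVLe (Vm m) F 1 →
                 ∀ h → odd h ≡ true → value (mono h) rounds nothing ≡ false
  odd-rejected clauses rep hd h odd-h with value (mono h) rounds nothing in eq
  ... | false = refl
  ... | true with stabilises (value (mono h)) (value-decreasing (mono h)) nodes
  ...   | s , s≤ , stable = ⊥-elim (irrefutable clauses h s stable
            (value-antitone (mono h) (≤-trans s≤ (n≤1+n _)) nothing eq)
            (hd (restriction h) (restriction-outside h) (odd-unsat rep h odd-h)))

  size-bound : All IsClause F → Represents m F → HdVLe (Vm m) F 1 → 1 ≤ r → r < m →
               (2 + (ℓ F + ℓ F)) * (suc (ℓ F + ℓ F) * (core * core) ^ suc r) < (m ∸ r) ^ suc r →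
               (2 + (ℓ F + ℓ F)) * (suc (ℓ F + ℓ F) * (suc (ℓ F) * suc (m * m) ^ r)) * 2 ^ suc r < 2 ^ q → ⊥
  size-bound clauses rep hd 1≤r r<m small-loss small-error =
    lower-bound nodes nodes-closed rounds (suc (ℓ F)) (here refl) 1≤r r<m (All.tabulate λ _ → few-rules)
      (λ f inj → let (β , sat , agree) = matching-extension rep f inj in falsified-survives f sat agree rounds nothing tt)
      (odd-rejected clauses rep hd)
      (subst (λ k → suc k * (k * (core * core) ^ suc r) < (m ∸ r) ^ suc r) (sym length-nodes) small-loss)
      (subst (λ k → suc k * (k * (suc (ℓ F) * suc (m * m) ^ r)) * 2 ^ suc r < 2 ^ q) (sym length-nodes) small-error)
    where
    identity : Vec (Fin m) m
    identity = Vec.allFin m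
    -- The identity matching extends to a satisfying assignment of `F`, so `F` has at most `ℓ F`
    -- clauses; one more rule is `x ∷ []`.
    few-rules : ∀ {x} → length (rules x) ≤ suc (ℓ F)
    few-rules {x} with matching-extension rep identity (λ i j eq → trans (sym (lookup∘tabulate id i)) (trans eq (lookup∘tabulate id j)))
    ... | β , sat , _ = s≤s (≤-trans (≤-reflexive (length-map (clauseRule x) F)) (length-≤-ℓ F sat))

-- Choice of parameters

open +-*-Solver using (solve; _:+_; _:*_; _:=_; con)

dyadic : ∀ m → 1 ≤ m → Σ ℕ λ n → 2 ^ n ≤ m × m < 2 ^ suc n
dyadic (suc zero)    _ = 0 , ≤-refl , ≤-refl
dyadic (suc (suc m)) _ with dyadic (suc m) (s≤s z≤n)
... | n , lo , hi with suc (suc m) <? 2 ^ suc n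
...   | yes lt = n , m≤n⇒m≤1+n lo , lt
...   | no ¬lt = suc n , ≮⇒≥ ¬lt , ≤-<-trans hi (^-monoʳ-< 2 ≤-refl (n<1+n (suc n)))

2^-cancel-< : ∀ {a b} → 2 ^ a < 2 ^ b → a < b
2^-cancel-< {a} {b} lt = ≰⇒> λ b≤a → <⇒≱ lt (^-monoʳ-≤ 2 b≤a)

n<2^n : ∀ n → n < 2 ^ n
n<2^n zero    = s≤s z≤n
n<2^n (suc n) = ≤-trans (+-mono-≤ (m^n>0 2 n) (n<2^n n)) (≤-reflexive (cong (2 ^ n +_) (sym (+-identityʳ _))))

-- (r + 1)³ ≤ 8 r³ carries the bound from r to r + 1.
cube-≤-8^ : ∀ d → 73 * ((5 + d) * ((5 + d) * (5 + d))) ≤ 2 ^ (3 * (5 + d))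
-- 5 is the first positive `r` with 73 r³ ≤ 2^(3r).
cube-≤-8^ zero    = ≤ᵇ⇒≤ _ _ _
cube-≤-8^ (suc d) = begin
  73 * ((6 + d) * ((6 + d) * (6 + d)))           ≤⟨ *-monoʳ-≤ 73 (*-mono-≤ double (*-mono-≤ double double)) ⟩
  73 * (2 * r * (2 * r * (2 * r)))               ≡⟨ solve 1 (λ r → con 73 :* (con 2 :* r :* (con 2 :* r :* (con 2 :* r))) := con 8 :* (con 73 :* (r :* (r :* r)))) refl r ⟩
  8 * (73 * (r * (r * r)))                       ≤⟨ *-monoʳ-≤ 8 (cube-≤-8^ d) ⟩
  2 ^ 3 * 2 ^ (3 * r)                            ≡⟨ sym (^-distribˡ-+-* 2 3 (3 * r)) ⟩
  2 ^ (3 + 3 * r)                                ≡⟨ cong (2 ^_) (sym (*-suc 3 r)) ⟩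
  2 ^ (3 * (6 + d))                              ∎
  where
  open ≤-Reasoning
  r : ℕ
  r = 5 + d
  double : 6 + d ≤ 2 * r
  double = ≤-trans (+-monoˡ-≤ r {1} {r} (s≤s z≤n)) (≤-reflexive (cong (r +_) (sym (+-identityʳ r))))

module Parameters (m r L : ℕ) (5≤r : 5 ≤ r) (big : 2 ^ (16 * r) ≤ m) (small : m < 2 ^ (32 * r)) (few : L < 2 ^ (r * r)) where

  open ≤-Reasoning

  -- The error count has exponent 67 r² + r + 3, which 72 r² exceeds for every r ≥ 1.
  q : ℕ
  q = 72 * (r * r)

  open Approximation m r q using (core)

  1≤r : 1 ≤ r
  1≤r = ≤-trans (s≤s z≤n) 5≤r

  r<m : r < m
  r<m = <-≤-trans (n<2^n r) (≤-trans (^-monoʳ-≤ 2 (m≤n*m r 16)) big)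

  rounds-bound : 2 + (L + L) ≤ 2 ^ suc (r * r)
  rounds-bound = begin
    2 + (L + L)                      ≡⟨ cong suc (sym (+-suc L L)) ⟩
    suc L + suc L                    ≤⟨ +-mono-≤ few few ⟩
    2 ^ (r * r) + 2 ^ (r * r)        ≡⟨ cong (2 ^ (r * r) +_) (sym (+-identityʳ _)) ⟩
    2 ^ suc (r * r)                  ∎

  nodes-bound : suc (L + L) ≤ 2 ^ suc (r * r)
  nodes-bound = ≤-trans (n≤1+n _) rounds-bound

  core-bound : core ≤ 2 ^ (4 * r)
  core-bound = begin
    r + 2 ^ r * q * r                          ≤⟨ +-monoˡ-≤ (2 ^ r * q * r) r-small ⟩
    2 ^ r * (r * (r * r)) + 2 ^ r * q * r      ≡⟨ solve 2 (λ r x → x :* (r :* (r :* r)) :+ x :* (con 72 :* (r :* r)) :* r := x :* (con 73 :* (r :* (r :* r)))) refl r (2 ^ r) ⟩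
    2 ^ r * (73 * (r * (r * r)))               ≤⟨ *-monoʳ-≤ (2 ^ r) (subst (λ r → 73 * (r * (r * r)) ≤ 2 ^ (3 * r)) (m+[n∸m]≡n 5≤r) (cube-≤-8^ (r ∸ 5))) ⟩
    2 ^ r * 2 ^ (3 * r)                        ≡⟨ sym (^-distribˡ-+-* 2 r (3 * r)) ⟩
    2 ^ (4 * r)                                ∎
    where
    r-small : r ≤ 2 ^ r * (r * (r * r))
    r-small = ≤-trans (≤-trans (≤-reflexive (sym (*-identityʳ r))) (*-monoʳ-≤ r (*-mono-≤ 1≤r 1≤r)))
                (≤-trans (≤-reflexive (sym (*-identityˡ _))) (*-monoˡ-≤ (r * (r * r)) (m^n>0 2 r)))

  board-bound : 2 ^ (15 * r) ≤ m ∸ r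
  board-bound = m+n≤o⇒m≤o∸n (2 ^ (15 * r)) (begin
    2 ^ (15 * r) + r                ≤⟨ +-monoʳ-≤ (2 ^ (15 * r)) (≤-trans (<⇒≤ (n<2^n r)) (^-monoʳ-≤ 2 (m≤n*m r 15))) ⟩
    2 ^ (15 * r) + 2 ^ (15 * r)     ≡⟨ cong (2 ^ (15 * r) +_) (sym (+-identityʳ _)) ⟩
    2 ^ suc (15 * r)                ≤⟨ ^-monoʳ-≤ 2 (+-monoˡ-≤ (15 * r) 1≤r) ⟩
    2 ^ (16 * r)                    ≤⟨ big ⟩
    m                               ∎)

  -- In exponents of 2: rounds and nodes give r² + 1 each and the branching 8r(r + 1), against 15r(r
  -- + 1) from `board-bound`.
  small-loss : (2 + (L + L)) * (suc (L + L) * (core * core) ^ suc r) < (m ∸ r) ^ suc r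
  small-loss = begin-strict
    (2 + (L + L)) * (suc (L + L) * (core * core) ^ suc r)
      ≤⟨ *-mono-≤ rounds-bound (*-mono-≤ nodes-bound (^-monoˡ-≤ (suc r) (*-mono-≤ core-bound core-bound))) ⟩
    2 ^ suc (r * r) * (2 ^ suc (r * r) * (2 ^ (4 * r) * 2 ^ (4 * r)) ^ suc r)
      ≡⟨ cong (λ x → 2 ^ suc (r * r) * (2 ^ suc (r * r) * x))
              (trans (cong (_^ suc r) (sym (^-distribˡ-+-* 2 (4 * r) (4 * r)))) (^-*-assoc 2 (4 * r + 4 * r) (suc r))) ⟩
    2 ^ suc (r * r) * (2 ^ suc (r * r) * 2 ^ ((4 * r + 4 * r) * suc r))
      ≡⟨ cong (2 ^ suc (r * r) *_) (sym (^-distribˡ-+-* 2 (suc (r * r)) _)) ⟩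
    2 ^ suc (r * r) * 2 ^ (suc (r * r) + (4 * r + 4 * r) * suc r)
      ≡⟨ sym (^-distribˡ-+-* 2 (suc (r * r)) _) ⟩
    2 ^ (suc (r * r) + (suc (r * r) + (4 * r + 4 * r) * suc r))
      <⟨ ^-monoʳ-< 2 ≤-refl (exponents r 1≤r) ⟩
    2 ^ (15 * r * suc r)
      ≡⟨ sym (^-*-assoc 2 (15 * r) (suc r)) ⟩
    (2 ^ (15 * r)) ^ suc r
      ≤⟨ ^-monoˡ-≤ (suc r) board-bound ⟩
    (m ∸ r) ^ suc r ∎
    where
    exponents : ∀ r → 1 ≤ r → suc (r * r) + (suc (r * r) + (4 * r + 4 * r) * suc r) < 15 * r * suc r
    -- The added polynomial is the exact slack at r = 1 + d.
    exponents (suc d) _ = ≤-trans (m≤m+n _ (9 + 17 * d + 5 * (d * d))) (≤-reflexive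
      (solve 1 (λ d → let r = con 1 :+ d in
        (con 1 :+ ((con 1 :+ r :* r) :+ ((con 1 :+ r :* r) :+ (con 4 :* r :+ con 4 :* r) :* (con 1 :+ r)))) :+ (con 9 :+ con 17 :* d :+ con 5 :* (d :* d))
        := con 15 :* r :* (con 1 :+ r)) refl d))

  edges-bound : suc (m * m) ^ r ≤ 2 ^ ((32 * r + 32 * r) * r)
  edges-bound = begin
    suc (m * m) ^ r                        ≤⟨ ^-monoˡ-≤ r (*-mono-< small small) ⟩
    (2 ^ (32 * r) * 2 ^ (32 * r)) ^ r      ≡⟨ cong (_^ r) (sym (^-distribˡ-+-* 2 (32 * r) (32 * r))) ⟩
    (2 ^ (32 * r + 32 * r)) ^ r            ≡⟨ ^-*-assoc 2 (32 * r + 32 * r) r ⟩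
    2 ^ ((32 * r + 32 * r) * r)            ∎

  small-error : (2 + (L + L)) * (suc (L + L) * (suc L * suc (m * m) ^ r)) * 2 ^ suc r < 2 ^ q
  small-error = begin-strict
    (2 + (L + L)) * (suc (L + L) * (suc L * suc (m * m) ^ r)) * 2 ^ suc r
      ≤⟨ *-monoˡ-≤ (2 ^ suc r) (*-mono-≤ rounds-bound (*-mono-≤ nodes-bound (*-mono-≤ few edges-bound))) ⟩
    2 ^ suc (r * r) * (2 ^ suc (r * r) * (2 ^ (r * r) * 2 ^ ((32 * r + 32 * r) * r))) * 2 ^ suc r
      ≡⟨ cong (λ x → 2 ^ suc (r * r) * (2 ^ suc (r * r) * x) * 2 ^ suc r) (sym (^-distribˡ-+-* 2 (r * r) _)) ⟩
    2 ^ suc (r * r) * (2 ^ suc (r * r) * 2 ^ (r * r + (32 * r + 32 * r) * r)) * 2 ^ suc r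
      ≡⟨ cong (λ x → 2 ^ suc (r * r) * x * 2 ^ suc r) (sym (^-distribˡ-+-* 2 (suc (r * r)) _)) ⟩
    2 ^ suc (r * r) * 2 ^ (suc (r * r) + (r * r + (32 * r + 32 * r) * r)) * 2 ^ suc r
      ≡⟨ cong (_* 2 ^ suc r) (sym (^-distribˡ-+-* 2 (suc (r * r)) _)) ⟩
    2 ^ (suc (r * r) + (suc (r * r) + (r * r + (32 * r + 32 * r) * r))) * 2 ^ suc r
      ≡⟨ sym (^-distribˡ-+-* 2 (suc (r * r) + (suc (r * r) + (r * r + (32 * r + 32 * r) * r))) (suc r)) ⟩
    2 ^ (suc (r * r) + (suc (r * r) + (r * r + (32 * r + 32 * r) * r)) + suc r)
      <⟨ ^-monoʳ-< 2 ≤-refl (exponents r 1≤r) ⟩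
    2 ^ q ∎
    where
    exponents : ∀ r → 1 ≤ r → suc (r * r) + (suc (r * r) + (r * r + (32 * r + 32 * r) * r)) + suc r < 72 * (r * r)
    exponents (suc d) _ = ≤-trans (m≤m+n _ (9 * d + 5 * (d * d))) (≤-reflexive
      (solve 1 (λ d → let r = con 1 :+ d in
        (con 1 :+ ((con 1 :+ r :* r) :+ ((con 1 :+ r :* r) :+ (r :* r :+ (con 32 :* r :+ con 32 :* r) :* r)) :+ (con 1 :+ r))) :+ (con 9 :* d :+ con 5 :* (d :* d))
        := con 72 :* (r :* r)) refl d))

theorem8p9 : Σ ℕ λ k → 1 ≤ k × Σ ℕ λ m₀ → ∀ m → m₀ ≤ m →
    ∀ (F : ClauseSet) → IsClauseSet F → Represents m F → HdVLe (Vm m) F 1 →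
    m ^ ⌊log₂ m ⌋ ≤ ℓ F ^ k
-- 1024 = 32² comes from `m` and its logarithm being bounded by 2^(32r) and 32r, against 2^(r²) for
-- `ℓ F`; the threshold 2^80 ensures r = ⌊n/16⌋ ≥ 5.
theorem8p9 = 1024 , s≤s z≤n , 2 ^ 80 , bound
  where
  open ≤-Reasoning
  bound : ∀ m → 2 ^ 80 ≤ m → ∀ (F : ClauseSet) → IsClauseSet F → Represents m F → HdVLe (Vm m) F 1 →
          m ^ ⌊log₂ m ⌋ ≤ ℓ F ^ 1024
  bound m large F (clauses , _) rep hd with dyadic m (≤-trans (m^n>0 2 80) large)
  ... | n , lo , hi = by-size (2 ^ (r * r) ≤? ℓ F)
    where
    r : ℕ
    r = n / 16
    n<16+16r : n < suc r * 16
    n<16+16r = ≤-<-trans (≤-reflexive (m≡m%n+[m/n]*n n 16)) (+-monoˡ-< (r * 16) (m%n<n n 16))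
    5≤r : 5 ≤ r
    5≤r = ≤-pred (*-cancelʳ-< 16 5 (suc r) (≤-<-trans (≤-pred (2^-cancel-< (≤-<-trans large hi))) n<16+16r))
    big : 2 ^ (16 * r) ≤ m
    big = ≤-trans (^-monoʳ-≤ 2 (≤-trans (≤-reflexive (*-comm 16 r)) (m/n*n≤m n 16))) lo
    suc-n≤32r : suc n ≤ 32 * r
    suc-n≤32r = begin
      suc n            ≤⟨ n<16+16r ⟩
      16 + r * 16      ≤⟨ +-monoˡ-≤ (r * 16) (*-monoˡ-≤ 16 (≤-trans (s≤s z≤n) 5≤r)) ⟩
      r * 16 + r * 16  ≡⟨ solve 1 (λ r → r :* con 16 :+ r :* con 16 := con 32 :* r) refl r ⟩
      32 * r           ∎
    small : m < 2 ^ (32 * r)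
    small = <-≤-trans hi (^-monoʳ-≤ 2 suc-n≤32r)
    log≤32r : ⌊log₂ m ⌋ ≤ 32 * r
    log≤32r = ≤-trans (⌊log₂⌋-mono-≤ (<⇒≤ small)) (≤-reflexive (⌊log₂[2^n]⌋≡n (32 * r)))
    by-size : Dec (2 ^ (r * r) ≤ ℓ F) → m ^ ⌊log₂ m ⌋ ≤ ℓ F ^ 1024
    by-size (no  short) = ⊥-elim (size-bound clauses rep hd 1≤r r<m small-loss small-error)
      where
      open Parameters m r (ℓ F) 5≤r big small (≰⇒> short)
      open Propagation m r q F using (size-bound)
    by-size (yes long) = begin
      m ^ ⌊log₂ m ⌋                   ≤⟨ ^-monoʳ-≤ m {{>-nonZero (≤-trans (m^n>0 2 80) large)}} log≤32r ⟩
      m ^ (32 * r)                    ≤⟨ ^-monoˡ-≤ (32 * r) (<⇒≤ small) ⟩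
      (2 ^ (32 * r)) ^ (32 * r)       ≡⟨ ^-*-assoc 2 (32 * r) (32 * r) ⟩
      2 ^ (32 * r * (32 * r))         ≡⟨ cong (2 ^_) (solve 1 (λ r → con 32 :* r :* (con 32 :* r) := r :* r :* con 1024) refl r) ⟩
      2 ^ (r * r * 1024)              ≡⟨ sym (^-*-assoc 2 (r * r) 1024) ⟩
      (2 ^ (r * r)) ^ 1024            ≤⟨ ^-monoˡ-≤ 1024 long ⟩
      ℓ F ^ 1024                      ∎
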